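{- Let $(\alpha,\beta,\gamma)\in\{(1,4,9),(2,3,5),(2,3,7)\}$. For all integers $k\ge 2$ and $n\ge k(3k+1)/2$, we have ${\rm TP}_{\alpha,\beta,\gamma}^{k}(n)\ge 0$, with strict inequality except for the following cases, in which the value is $0$: \begin{align*} &{\rm TP}_{1,4,9}^{2}(n)=0\ \text{ for } n=21,24,25;\\ &{\rm TP}_{2,3,5}^{2}(n)=0\ \text{ for } n=20,23,\quad\text{and}\quad {\rm TP}_{2,3,5}^{k}\left(\tfrac{k(3k+1)}{2}+1\right)=0\ \text{ for all } k\ge 2;\\ &{\rm TP}_{2,3,7}^{2}(3j)=0\ \text{ for integers } 4\le j\le 9,\quad\text{and}\quad {\rm TP}_{2,3,7}^{k}\left(\tfrac{k(3k+1)}{2}+1\right)=0\ \text{ for all } k\ge 2. \end{align*}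
   Context: For distinct pairwise coprime integers $\alpha,\beta,\gamma\ge 1$ and an integer $k\ge 1$, the integers ${\rm TP}_{\alpha,\beta,\gamma}^{k}(n)$ ($n\ge 0$) are defined by the formal power series identity $$\sum_{n\ge 0}{\rm TP}_{\alpha,\beta,\gamma}^{k}(n)q^n=\frac{(-1)^k}{(1-q^\alpha)(1-q^\beta)(1-q^\gamma)}\sum_{j\ge k}(-1)^jq^{j(3j+1)/2}\left(1-q^{2j+1}\right).$$ -}

module Defs where

open import Data.Empty using (⊥-elim)
open import Data.Integer as ℤ using (ℤ; 0ℤ; 1ℤ; -1ℤ)
import Data.Integer.Properties as ℤ
open import Data.Integer.Tactic.RingSolver using (solve-∀)
open import Data.List using (_∷_; [])
open import Data.List.Membership.Propositional using (_∈_)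
open import Data.Nat
  using (ℕ; zero; suc; _+_; _*_; _∸_; _/_; _≟_; _≤_; _<_; _≤?_; NonZero; z≤n; s≤s; >-nonZero⁻¹)
import Data.Nat.Properties as ℕ
import Data.Nat.DivMod as ℕ
open import Data.Nat.Divisibility
  using (_∣_; _∤_; _∣?_; _∣0; ∣-refl; ∣m∸n∣n⇒∣m; ∣m+n∣m⇒∣n; >⇒∤)
open import Data.Product using (_×_; _,_)
open import Data.Bool using (if_then_else_)
open import Relation.Binary.PropositionalEquality
open import Relation.Nullary using (yes; no; does)
open import Relation.Nullary.Decidable using (dec-true; dec-false)

-- A formal power series in q over ℤ is its sequence of coefficients.
PowerSeries : Set
PowerSeries = ℕ → ℤ

-- Σ≤ n f = f 0 + f 1 + ⋯ + f n
Σ≤ : ℕ → (ℕ → ℤ) → ℤ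
Σ≤ zero    f = f 0
Σ≤ (suc n) f = Σ≤ n f ℤ.+ f (suc n)

infix  9 q^_
infixl 7 _⊛_
infixr 8 _·_
infixl 6 _⊝_

q^_ : ℕ → PowerSeries
(q^ m) n = if does (m ≟ n) then 1ℤ else 0ℤ

𝟙 : PowerSeries
𝟙 = q^ 0

_⊝_ : PowerSeries → PowerSeries → PowerSeries
(f ⊝ g) n = f n ℤ.- g n

_·_ : ℤ → PowerSeries → PowerSeries
(c · f) n = c ℤ.* f n

_⊛_ : PowerSeries → PowerSeries → PowerSeries
(f ⊛ g) n = Σ≤ n λ i → f i ℤ.* g (n ∸ i)

-- The geometric series; 1/[1-q^]-inverse below shows that it is the inverse of 1 - q^a.
1/[1-q^_] : (a : ℕ) → .{{NonZero a}} → PowerSeries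
1/[1-q^ a ] n = if does (a ∣? n) then 1ℤ else 0ℤ

-- The infinite sum of f j over j ≥ k, for families in which f j only has terms of
-- degree ≥ j: then only the j ≤ n contribute to the coefficient of q^n, and the
-- sum over k ≤ j ≤ k + n contains all of these.
Σ≥ : ℕ → (ℕ → PowerSeries) → PowerSeries
Σ≥ k f n = Σ≤ n λ i → f (k + i) n

-- j(3j+1) is always even, so the division is exact.
pent : ℕ → ℕ
pent j = j * (3 * j + 1) / 2

pentTerm : ℕ → PowerSeries
pentTerm j = (-1ℤ ℤ.^ j) · q^ (pent j) ⊛ (𝟙 ⊝ q^ (2 * j + 1))

TP : (α β γ : ℕ) → .{{NonZero α}} → .{{NonZero β}} → .{{NonZero γ}} → ℕ → ℕ → ℤ
TP α β γ k =
  (-1ℤ ℤ.^ k) · (1/[1-q^ α ] ⊛ 1/[1-q^ β ] ⊛ 1/[1-q^ γ ] ⊛ Σ≥ k pentTerm)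

-- Exceptional (α , β , γ) k n lists the (k , n) at which TP α β γ k n vanishes.
data Exceptional : ℕ × ℕ × ℕ → ℕ → ℕ → Set where
  exc-149 : ∀ {n} → n ∈ 21 ∷ 24 ∷ 25 ∷ [] → Exceptional (1 , 4 , 9) 2 n
  exc-235 : ∀ {n} → n ∈ 20 ∷ 23 ∷ [] → Exceptional (2 , 3 , 5) 2 n
  suc-235 : ∀ {k n} → 2 ≤ k → n ≡ pent k + 1 → Exceptional (2 , 3 , 5) k n
  exc-237 : ∀ {j n} → 4 ≤ j → j ≤ 9 → n ≡ 3 * j → Exceptional (2 , 3 , 7) 2 n
  suc-237 : ∀ {k n} → 2 ≤ k → n ≡ pent k + 1 → Exceptional (2 , 3 , 7) k n

-- The remaining lemmas justify 1/[1-q^_] and Σ≥.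

Σ≤-zero : ∀ n {f} → (∀ i → i ≤ n → f i ≡ 0ℤ) → Σ≤ n f ≡ 0ℤ
Σ≤-zero zero    f≡0 = f≡0 0 z≤n
Σ≤-zero (suc n) f≡0 =
  cong₂ ℤ._+_ (Σ≤-zero n λ i i≤n → f≡0 i (ℕ.m≤n⇒m≤1+n i≤n)) (f≡0 (suc n) ℕ.≤-refl)

Σ≤-single : ∀ n {f} m → m ≤ n → (∀ i → i ≢ m → f i ≡ 0ℤ) → Σ≤ n f ≡ f m
Σ≤-single zero    .0 z≤n _ = refl
Σ≤-single (suc n) {f} m m≤1+n f≡0 with m ≟ suc n
... | yes refl = trans
  (cong (ℤ._+ f m) (Σ≤-zero n λ i i≤n → f≡0 i (ℕ.<⇒≢ (s≤s i≤n))))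
  (ℤ.+-identityˡ (f m))
... | no m≢1+n = trans
  (cong₂ ℤ._+_ (Σ≤-single n m (ℕ.≤-pred (ℕ.≤∧≢⇒< m≤1+n m≢1+n)) f≡0)
               (f≡0 (suc n) (≢-sym m≢1+n)))
  (ℤ.+-identityʳ (f m))

Σ≤-minus : ∀ n {f g h : ℕ → ℤ} → (∀ i → h i ≡ f i ℤ.- g i) → Σ≤ n h ≡ Σ≤ n f ℤ.- Σ≤ n g
Σ≤-minus zero    h≡f-g = h≡f-g 0
Σ≤-minus (suc n) {f} {g} h≡f-g = trans
  (cong₂ ℤ._+_ (Σ≤-minus n h≡f-g) (h≡f-g (suc n)))
  (rearrange (Σ≤ n f) (Σ≤ n g) (f (suc n)) (g (suc n)))
  where
  rearrange : ∀ a b c d → (a ℤ.- b) ℤ.+ (c ℤ.- d) ≡ (a ℤ.+ c) ℤ.- (b ℤ.+ d)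
  rearrange = solve-∀

q^-diag : ∀ m → (q^ m) m ≡ 1ℤ
q^-diag m = cong (if_then 1ℤ else 0ℤ) (dec-true (m ≟ m) refl)

q^-off : ∀ m {i} → i ≢ m → (q^ m) i ≡ 0ℤ
q^-off m {i} i≢m = cong (if_then 1ℤ else 0ℤ) (dec-false (m ≟ i) (≢-sym i≢m))

q^-⊛ : ∀ m g n → m ≤ n → (q^ m ⊛ g) n ≡ g (n ∸ m)
q^-⊛ m g n m≤n = trans
  (Σ≤-single n m m≤n λ i i≢m → cong (ℤ._* g (n ∸ i)) (q^-off m i≢m))
  (trans (cong (ℤ._* g (n ∸ m)) (q^-diag m)) (ℤ.*-identityˡ _))

q^-⊛-< : ∀ m g n → n < m → (q^ m ⊛ g) n ≡ 0ℤ
q^-⊛-< m g n n<m = Σ≤-zero n λ i i≤n →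
  cong (ℤ._* g (n ∸ i)) (q^-off m (ℕ.<⇒≢ (ℕ.≤-<-trans i≤n n<m)))

⊝-⊛ : ∀ f g h n → ((f ⊝ g) ⊛ h) n ≡ (f ⊛ h) n ℤ.- (g ⊛ h) n
⊝-⊛ f g h n = Σ≤-minus n λ i → distrib (f i) (g i) (h (n ∸ i))
  where
  distrib : ∀ a b c → (a ℤ.- b) ℤ.* c ≡ a ℤ.* c ℤ.- b ℤ.* c
  distrib = solve-∀

1/[1-q^]-∣ : ∀ a n .{{_ : NonZero a}} → a ∣ n → 1/[1-q^ a ] n ≡ 1ℤ
1/[1-q^]-∣ a n a∣n = cong (if_then 1ℤ else 0ℤ) (dec-true (a ∣? n) a∣n)

1/[1-q^]-∤ : ∀ a n .{{_ : NonZero a}} → a ∤ n → 1/[1-q^ a ] n ≡ 0ℤ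
1/[1-q^]-∤ a n a∤n = cong (if_then 1ℤ else 0ℤ) (dec-false (a ∣? n) a∤n)

1/[1-q^]-periodic : ∀ a n .{{_ : NonZero a}} → a ≤ n → 1/[1-q^ a ] n ≡ 1/[1-q^ a ] (n ∸ a)
1/[1-q^]-periodic a n a≤n with a ∣? (n ∸ a)
... | yes d = 1/[1-q^]-∣ a n (∣m∸n∣n⇒∣m a a≤n d ∣-refl)
... | no ¬d = 1/[1-q^]-∤ a n λ a∣n →
  ¬d (∣m+n∣m⇒∣n (subst (a ∣_) (sym (ℕ.m+[n∸m]≡n a≤n)) a∣n) ∣-refl)

1/[1-q^]-inverse : ∀ a .{{_ : NonZero a}} n → ((𝟙 ⊝ q^ a) ⊛ 1/[1-q^ a ]) n ≡ 𝟙 n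
1/[1-q^]-inverse a n = trans (⊝-⊛ 𝟙 (q^ a) 1/[1-q^ a ] n)
  (trans (cong (ℤ._- (q^ a ⊛ 1/[1-q^ a ]) n) (q^-⊛ 0 1/[1-q^ a ] n z≤n)) (go n))
  where
  go : ∀ n → 1/[1-q^ a ] n ℤ.- (q^ a ⊛ 1/[1-q^ a ]) n ≡ 𝟙 n
  go zero = cong₂ ℤ._-_ (1/[1-q^]-∣ a 0 (a ∣0)) (q^-⊛-< a 1/[1-q^ a ] 0 (>-nonZero⁻¹ a))
  go n@(suc _) with a ≤? n
  ... | yes a≤n = trans
    (cong₂ ℤ._-_ (1/[1-q^]-periodic a n a≤n) (q^-⊛ a 1/[1-q^ a ] n a≤n))
    (ℤ.+-inverseʳ (1/[1-q^ a ] (n ∸ a)))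
  ... | no a≰n = cong₂ ℤ._-_
    (1/[1-q^]-∤ a n (>⇒∤ (ℕ.≰⇒> a≰n))) (q^-⊛-< a 1/[1-q^ a ] n (ℕ.≰⇒> a≰n))

j≤pent : ∀ j → j ≤ pent j
j≤pent zero      = z≤n
j≤pent j@(suc i) = subst (_≤ pent j) (ℕ.m*n/n≡m j 2)
  (ℕ./-monoˡ-≤ 2 (ℕ.*-monoʳ-≤ j (ℕ.≤-trans (ℕ.*-mono-≤ {2} {3} {1} {j} (s≤s (s≤s z≤n)) (s≤s z≤n)) (ℕ.m≤m+n (3 * j) 1))))

pentTerm-vanishes : ∀ j n → n < j → pentTerm j n ≡ 0ℤ
pentTerm-vanishes j n n<j = Σ≤-zero n λ i i≤n →
  cong (ℤ._* (𝟙 ⊝ q^ (2 * j + 1)) (n ∸ i))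
    (trans (cong ((-1ℤ ℤ.^ j) ℤ.*_) (q^-off (pent j) (ℕ.<⇒≢ (ℕ.<-≤-trans (ℕ.≤-<-trans i≤n n<j) (j≤pent j)))))
           (ℤ.*-zeroʳ (-1ℤ ℤ.^ j)))

{-# OPTIONS --safe #-}

-- Let p(m) be the coefficients of 1/(1-q^α)(1-q^β)(1-q^γ) and R k x = TP^k(k(3k+1)/2 + x).
-- Then R k x = p(x) - p(x-2k-1) - R (k+1) (x-3k-2), where p and R vanish at negative arguments.
-- As α, β, γ are pairwise coprime, 2αβγ·p(m) = (m+σ/2)² + ρ(m) with σ = α+β+γ and ρ periodic
-- modulo αβγ, hence bounded.  With ρ = 0 the recursion has an exact polynomial solution; lowering
-- it by a linear term that pays for ρ at each step, and by a multiple of n that pays for the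
-- truncation of p at 0, gives a quadratic lower bound L for 2αβγ·R.  L is positive for x ≥ 6k+7
-- once k ≥ 14, and for (k-1)x ≥ 1500 (up to rounding) if 2 ≤ k < 14.  If k ≥ 14 and x < 6k+7,
-- then R k x has at most four terms, and the finitely many remaining pairs are computed.

module Submission where

open import Defs
open import Data.Bool using (true; false; T; if_then_else_)
open import Data.Empty using (⊥-elim)
open import Data.Integer as ℤ using (ℤ; +_; 0ℤ; 1ℤ; -1ℤ)
import Data.Integer.Properties as ℤ
open import Data.Integer.Tactic.RingSolver using (solve-∀)
open import Data.List using (List; _∷_; [])
open import Data.List.Membership.Propositional using (_∈_)
open import Data.List.Relation.Unary.Any using (here; there)
open import Data.Nat
  using (ℕ; zero; suc; _+_; _*_; _∸_; _/_; _%_; _≤_; _<_; _<ᵇ_; _≟_; _≤?_; _<?_;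
         NonZero; ≢-nonZero⁻¹; z≤n; s≤s)
open import Data.Nat.DivMod using (m*n/n≡m; +-distrib-/-∣ʳ; m≡m%n+[m/n]*n; m%n<n)
open import Data.Nat.Divisibility using (n∣m*n; >⇒∤; _∣0)
import Data.Nat.Properties as ℕ
import Data.Nat.Tactic.RingSolver as ℕSolver
open import Data.List.Membership.DecPropositional _≟_ using (_∈?_)
open import Data.Product using (_×_; ∃; _,_; proj₂)
open import Data.Sum using (_⊎_; inj₁; inj₂)
open import Data.Unit using (tt)
open import Function using (case_of_)
open import Relation.Binary.PropositionalEquality
open import Relation.Nullary using (Dec; does; yes; no; ¬_)
open import Relation.Nullary.Decidable using (_⊎-dec_; _×-dec_)

-- Convolution of power series

Σ≤-cong : ∀ n {f g} → (∀ i → i ≤ n → f i ≡ g i) → Σ≤ n f ≡ Σ≤ n g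
Σ≤-cong zero    f≡g = f≡g 0 z≤n
Σ≤-cong (suc n) f≡g =
  cong₂ ℤ._+_ (Σ≤-cong n λ i i≤n → f≡g i (ℕ.m≤n⇒m≤1+n i≤n)) (f≡g (suc n) ℕ.≤-refl)

Σ≤-plus : ∀ n (f g : ℕ → ℤ) → Σ≤ n (λ i → f i ℤ.+ g i) ≡ Σ≤ n f ℤ.+ Σ≤ n g
Σ≤-plus zero    f g = refl
Σ≤-plus (suc n) f g = trans
  (cong (ℤ._+ (f (suc n) ℤ.+ g (suc n))) (Σ≤-plus n f g))
  (rearrange (Σ≤ n f) (Σ≤ n g) (f (suc n)) (g (suc n)))
  where
  rearrange : ∀ a b c d → (a ℤ.+ b) ℤ.+ (c ℤ.+ d) ≡ (a ℤ.+ c) ℤ.+ (b ℤ.+ d)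
  rearrange = solve-∀

Σ≤-*ˡ : ∀ n c (f : ℕ → ℤ) → Σ≤ n (λ i → c ℤ.* f i) ≡ c ℤ.* Σ≤ n f
Σ≤-*ˡ zero    c f = refl
Σ≤-*ˡ (suc n) c f = trans
  (cong (ℤ._+ c ℤ.* f (suc n)) (Σ≤-*ˡ n c f))
  (sym (ℤ.*-distribˡ-+ c (Σ≤ n f) (f (suc n))))

Σ≤-suc : ∀ n (f : ℕ → ℤ) → Σ≤ (suc n) f ≡ f 0 ℤ.+ Σ≤ n (λ i → f (suc i))
Σ≤-suc zero    f = refl
Σ≤-suc (suc n) f = trans
  (cong (ℤ._+ f (suc (suc n))) (Σ≤-suc n f))
  (ℤ.+-assoc (f 0) (Σ≤ n (λ i → f (suc i))) (f (suc (suc n))))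

Σ≤-split : ∀ m n (f : ℕ → ℤ) → Σ≤ (m + suc n) f ≡ Σ≤ m f ℤ.+ Σ≤ n (λ i → f (m + suc i))
Σ≤-split m zero f rewrite ℕ.+-suc m 0 | ℕ.+-identityʳ m = refl
Σ≤-split m (suc n) f rewrite ℕ.+-suc m (suc n) = trans
  (cong (ℤ._+ f (suc (m + suc n))) (Σ≤-split m n f))
  (ℤ.+-assoc (Σ≤ m f) (Σ≤ n (λ i → f (m + suc i))) (f (suc (m + suc n))))

⊛-congʳ : ∀ f {g h} n → (∀ m → m ≤ n → g m ≡ h m) → (f ⊛ g) n ≡ (f ⊛ h) n
⊛-congʳ f n g≡h = Σ≤-cong n λ i _ → cong (f i ℤ.*_) (g≡h (n ∸ i) (ℕ.m∸n≤m n i))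

⊛-zeroʳ : ∀ f {g} n → (∀ m → m ≤ n → g m ≡ 0ℤ) → (f ⊛ g) n ≡ 0ℤ
⊛-zeroʳ f n g≡0 = Σ≤-zero n λ i _ →
  trans (cong (f i ℤ.*_) (g≡0 (n ∸ i) (ℕ.m∸n≤m n i))) (ℤ.*-zeroʳ (f i))

⊛-distribˡ-+ : ∀ f g h n → (f ⊛ λ m → g m ℤ.+ h m) n ≡ (f ⊛ g) n ℤ.+ (f ⊛ h) n
⊛-distribˡ-+ f g h n = trans
  (Σ≤-cong n λ i _ → ℤ.*-distribˡ-+ (f i) (g (n ∸ i)) (h (n ∸ i)))
  (Σ≤-plus n (λ i → f i ℤ.* g (n ∸ i)) (λ i → f i ℤ.* h (n ∸ i)))

⊛-distribˡ-⊝ : ∀ f g h n → (f ⊛ (g ⊝ h)) n ≡ (f ⊛ g) n ℤ.- (f ⊛ h) n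
⊛-distribˡ-⊝ f g h n = Σ≤-minus n λ i → distrib (f i) (g (n ∸ i)) (h (n ∸ i))
  where
  distrib : ∀ a b c → a ℤ.* (b ℤ.- c) ≡ a ℤ.* b ℤ.- a ℤ.* c
  distrib = solve-∀

⊛-·ʳ : ∀ c f g n → (f ⊛ (c · g)) n ≡ c ℤ.* (f ⊛ g) n
⊛-·ʳ c f g n = trans
  (Σ≤-cong n λ i _ → swap c (f i) (g (n ∸ i)))
  (Σ≤-*ˡ n c (λ i → f i ℤ.* g (n ∸ i)))
  where
  swap : ∀ c a b → a ℤ.* (c ℤ.* b) ≡ c ℤ.* (a ℤ.* b)
  swap = solve-∀

·-⊛ : ∀ c f g n → ((c · f) ⊛ g) n ≡ c ℤ.* (f ⊛ g) n
·-⊛ c f g n = trans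
  (Σ≤-cong n λ i _ → ℤ.*-assoc c (f i) (g (n ∸ i)))
  (Σ≤-*ˡ n c (λ i → f i ℤ.* g (n ∸ i)))

⊛-q^ : ∀ f m x → (f ⊛ q^ m) (m + x) ≡ f x
⊛-q^ f m x = trans
  (Σ≤-cong (m + x) λ i i≤ → lemma i i≤)
  (trans (Σ≤-single (m + x) {λ i → f i ℤ.* (q^ x) i} x (ℕ.m≤n+m x m) λ i i≢x → trans (cong (f i ℤ.*_) (q^-off x i≢x)) (ℤ.*-zeroʳ (f i)))
         (trans (cong (f x ℤ.*_) (q^-diag x)) (ℤ.*-identityʳ (f x))))
  where
  -- Both factors after `f i` are the indicator of i = x.
  lemma : ∀ i → i ≤ m + x → f i ℤ.* (q^ m) (m + x ∸ i) ≡ f i ℤ.* (q^ x) i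
  lemma i i≤ = case x ≟ i of λ where
    (yes refl) → cong (f x ℤ.*_) (trans (cong (q^ m) (ℕ.m+n∸n≡m m x)) (trans (q^-diag m) (sym (q^-diag x))))
    (no x≢i)   → cong (f i ℤ.*_) (trans
      (q^-off m λ eq → x≢i (sym (ℕ.+-cancelˡ-≡ m i x (trans (cong (_+ i) (sym eq)) (ℕ.m∸n+n≡m i≤)))))
      (sym (q^-off x λ i≡x → x≢i (sym i≡x))))

⊛-q^-< : ∀ f m n → n < m → (f ⊛ q^ m) n ≡ 0ℤ
⊛-q^-< f m n n<m = ⊛-zeroʳ f n λ i i≤n → q^-off m (ℕ.<⇒≢ (ℕ.≤-<-trans i≤n n<m))

q^-shift : ∀ a c x → (q^ (a + c)) (a + x) ≡ (q^ c) x
q^-shift a c x = case c ≟ x of λ where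
  (yes refl) → trans (q^-diag (a + c)) (sym (q^-diag c))
  (no c≢x)   → trans (q^-off (a + c) λ eq → c≢x (sym (ℕ.+-cancelˡ-≡ a x c eq)))
                     (sym (q^-off c λ x≡c → c≢x (sym x≡c)))

-- The two sums end at the indices `k + n` and `suc k + n`. The extra last term has index
-- `k + suc n`, which exceeds `n`, so it vanishes.
Σ≥-unfold : ∀ k F n → (∀ j → n < j → F j n ≡ 0ℤ) → Σ≥ k F n ≡ F k n ℤ.+ Σ≥ (suc k) F n
Σ≥-unfold k F n F≡0 = begin
  Σ≤ n (λ i → F (k + i) n)                                       ≡⟨ ℤ.+-identityʳ _ ⟨
  Σ≤ n (λ i → F (k + i) n) ℤ.+ 0ℤ                                ≡⟨ cong (λ z → Σ≤ n (λ i → F (k + i) n) ℤ.+ z) (F≡0 (k + suc n) (ℕ.m≤n+m (suc n) k)) ⟨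
  Σ≤ (suc n) (λ i → F (k + i) n)                                 ≡⟨ Σ≤-suc n (λ i → F (k + i) n) ⟩
  F (k + 0) n ℤ.+ Σ≤ n (λ i → F (k + suc i) n)
    ≡⟨ cong₂ ℤ._+_ (cong (λ j → F j n) (ℕ.+-identityʳ k)) (Σ≤-cong n λ i _ → cong (λ j → F j n) (ℕ.+-suc k i)) ⟩
  F k n ℤ.+ Σ≥ (suc k) F n                                       ∎
  where open ≡-Reasoning

⊛-geometric-< : ∀ f a .{{_ : NonZero a}} n → n < a → (f ⊛ 1/[1-q^ a ]) n ≡ f n
⊛-geometric-< f a n n<a = trans (⊛-congʳ f n λ m m≤n → lemma m m≤n) (⊛-q^ f 0 n)
  where
  lemma : ∀ m → m ≤ n → 1/[1-q^ a ] m ≡ 𝟙 m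
  lemma zero    _   = 1/[1-q^]-∣ a 0 (a ∣0)
  lemma (suc m) m<n = 1/[1-q^]-∤ a (suc m) (>⇒∤ (ℕ.≤-<-trans m<n n<a))

-- This is G = f + q^a G for G = f/(1 - q^a). Split after index n: in the first part the geometric
-- series is shifted by its period a; in the last a terms its argument is below a, where it agrees
-- with 1, so only f (n + a) remains.
⊛-geometric-+ : ∀ f a .{{_ : NonZero a}} n →
  (f ⊛ 1/[1-q^ a ]) (n + a) ≡ (f ⊛ 1/[1-q^ a ]) n ℤ.+ f (n + a)
⊛-geometric-+ f (suc a) n = trans (Σ≤-split n a (λ i → f i ℤ.* g (n + suc a ∸ i)))
  (cong₂ ℤ._+_
    (Σ≤-cong n λ i i≤n → cong (f i ℤ.*_) (trans
      (1/[1-q^]-periodic (suc a) (n + suc a ∸ i) (ℕ.m+n≤o⇒m≤o∸n (suc a) (subst (suc a + i ≤_) (ℕ.+-comm (suc a) n) (ℕ.+-monoʳ-≤ (suc a) i≤n))))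
      (cong g (trans (cong (_∸ suc a) (ℕ.+-∸-comm (suc a) i≤n)) (ℕ.m+n∸n≡m (n ∸ i) (suc a))))))
    (trans (Σ≤-cong a λ i i≤a → cong (f (n + suc i) ℤ.*_) (cong g (ℕ.[m+n]∸[m+o]≡n∸o n (suc a) (suc i))))
           (⊛-geometric-< (λ i → f (n + suc i)) (suc a) a ℕ.≤-refl)))
  where
  g : PowerSeries
  g = 1/[1-q^ suc a ]

-- Recursion for truncated pentagonal sums

pent-suc : ∀ k → pent (suc k) ≡ pent k + (k + k + k + 2)
pent-suc k = begin
  suc k * (3 * suc k + 1) / 2                    ≡⟨ cong (_/ 2) (expand k) ⟩
  (k * (3 * k + 1) + (k + k + k + 2) * 2) / 2    ≡⟨ +-distrib-/-∣ʳ (k * (3 * k + 1)) (n∣m*n (k + k + k + 2)) ⟩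
  pent k + (k + k + k + 2) * 2 / 2               ≡⟨ cong (_+_ (pent k)) (m*n/n≡m (k + k + k + 2) 2) ⟩
  pent k + (k + k + k + 2)                       ∎
  where
  open ≡-Reasoning
  expand : ∀ k → suc k * (3 * suc k + 1) ≡ k * (3 * k + 1) + (k + k + k + 2) * 2
  expand = ℕSolver.solve-∀

pent≤pent-+ : ∀ k i → pent k ≤ pent (k + i)
pent≤pent-+ k zero    = ℕ.≤-reflexive (cong pent (sym (ℕ.+-identityʳ k)))
pent≤pent-+ k (suc i) = ℕ.≤-trans (pent≤pent-+ k i)
  (subst (pent (k + i) ≤_) (trans (sym (pent-suc (k + i))) (cong pent (sym (ℕ.+-suc k i)))) (ℕ.m≤m+n _ _))

pentTerm≡ : ∀ j m → pentTerm j m ≡ ((-1ℤ ℤ.^ j) · (q^ (pent j) ⊝ q^ (pent j + (2 * j + 1)))) m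
pentTerm≡ j m = trans (·-⊛ (-1ℤ ℤ.^ j) (q^ (pent j)) (𝟙 ⊝ q^ (2 * j + 1)) m)
                      (cong ((-1ℤ ℤ.^ j) ℤ.*_) (go m))
  where
  a c : ℕ
  a = pent j
  c = 2 * j + 1
  go : ∀ m → (q^ a ⊛ (𝟙 ⊝ q^ c)) m ≡ (q^ a ⊝ q^ (a + c)) m
  go m with a ≤? m
  ... | yes a≤m = trans (q^-⊛ a (𝟙 ⊝ q^ c) m a≤m) (cong₂ ℤ._-_
    (trans (sym (q^-shift a 0 (m ∸ a))) (cong₂ q^_ (ℕ.+-identityʳ a) (ℕ.m+[n∸m]≡n a≤m)))
    (trans (sym (q^-shift a c (m ∸ a))) (cong (q^ (a + c)) (ℕ.m+[n∸m]≡n a≤m))))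
  ... | no a≰m = trans (q^-⊛-< a (𝟙 ⊝ q^ c) m m<a) (sym (cong₂ ℤ._-_
    (q^-off a (ℕ.<⇒≢ m<a)) (q^-off (a + c) (ℕ.<⇒≢ (ℕ.<-≤-trans m<a (ℕ.m≤m+n a c))))))
    where m<a = ℕ.≰⇒> a≰m

pentTerm-zero : ∀ j n → n < pent j → pentTerm j n ≡ 0ℤ
pentTerm-zero j n n<p = trans (pentTerm≡ j n) (trans
  (cong ((-1ℤ ℤ.^ j) ℤ.*_) (cong₂ ℤ._-_ (q^-off (pent j) (ℕ.<⇒≢ n<p))
     (q^-off (pent j + (2 * j + 1)) (ℕ.<⇒≢ (ℕ.<-≤-trans n<p (ℕ.m≤m+n _ _))))))
  (ℤ.*-zeroʳ (-1ℤ ℤ.^ j)))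

sign²≡1 : ∀ k → (-1ℤ ℤ.^ k) ℤ.* (-1ℤ ℤ.^ k) ≡ 1ℤ
sign²≡1 zero    = refl
sign²≡1 (suc k) = trans (double-neg (-1ℤ ℤ.^ k)) (sign²≡1 k)
  where
  double-neg : ∀ e → (-1ℤ ℤ.* e) ℤ.* (-1ℤ ℤ.* e) ≡ e ℤ.* e
  double-neg = solve-∀

module Truncated (f : PowerSeries) where

  -- For f = 1/((1 - q^α)(1 - q^β)(1 - q^γ)) this is `TP α β γ k` by definition.
  tail : ℕ → PowerSeries
  tail k = (-1ℤ ℤ.^ k) · (f ⊛ Σ≥ k pentTerm)

  tail-< : ∀ k n → n < pent k → tail k n ≡ 0ℤ
  tail-< k n n<p = trans
    (cong ((-1ℤ ℤ.^ k) ℤ.*_) (⊛-zeroʳ f n λ m m≤n → Σ≤-zero m λ i _ →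
      pentTerm-zero (k + i) m (ℕ.<-≤-trans (ℕ.≤-<-trans m≤n n<p) (pent≤pent-+ k i))))
    (ℤ.*-zeroʳ (-1ℤ ℤ.^ k))

  -- Split off the term j = k. Its sign cancels against the outer one, while the remaining sum keeps
  -- the sign e = -(-1)^(k+1), whence the minus before `tail (suc k)`.
  tail-suc : ∀ k n → tail k n ≡
    ((f ⊛ q^ (pent k)) n ℤ.- (f ⊛ q^ (pent k + (2 * k + 1))) n) ℤ.- tail (suc k) n
  tail-suc k n = begin
    e ℤ.* (f ⊛ Σ≥ k pentTerm) n
      ≡⟨ cong (e ℤ.*_) (⊛-congʳ f n λ m _ → Σ≥-unfold k pentTerm m λ j → pentTerm-vanishes j m) ⟩
    e ℤ.* (f ⊛ λ m → pentTerm k m ℤ.+ Σ≥ (suc k) pentTerm m) n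
      ≡⟨ cong (e ℤ.*_) (⊛-distribˡ-+ f (pentTerm k) (Σ≥ (suc k) pentTerm) n) ⟩
    e ℤ.* ((f ⊛ pentTerm k) n ℤ.+ S)
      ≡⟨ cong (λ z → e ℤ.* (z ℤ.+ S)) (⊛-congʳ f n λ m _ → pentTerm≡ k m) ⟩
    e ℤ.* ((f ⊛ (e · (q^ (pent k) ⊝ q^ (pent k + (2 * k + 1))))) n ℤ.+ S)
      ≡⟨ cong (λ z → e ℤ.* (z ℤ.+ S)) (trans (⊛-·ʳ e f (g ⊝ h) n) (cong (e ℤ.*_) (⊛-distribˡ-⊝ f g h n))) ⟩
    e ℤ.* (e ℤ.* d ℤ.+ S)
      ≡⟨ regroup e d S ⟩
    (e ℤ.* e) ℤ.* d ℤ.- (-1ℤ ℤ.* e) ℤ.* S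
      ≡⟨ cong (ℤ._- tail (suc k) n) (trans (cong (ℤ._* d) (sign²≡1 k)) (ℤ.*-identityˡ d)) ⟩
    d ℤ.- tail (suc k) n ∎
    where
    open ≡-Reasoning
    e d S : ℤ
    e = -1ℤ ℤ.^ k
    d = (f ⊛ q^ (pent k)) n ℤ.- (f ⊛ q^ (pent k + (2 * k + 1))) n
    g h : PowerSeries
    g = q^ (pent k)
    h = q^ (pent k + (2 * k + 1))
    S = (f ⊛ Σ≥ (suc k) pentTerm) n
    regroup : ∀ e d S → e ℤ.* (e ℤ.* d ℤ.+ S) ≡ (e ℤ.* e) ℤ.* d ℤ.- (-1ℤ ℤ.* e) ℤ.* S
    regroup = solve-∀

  -- Below, 2k and 3k are written k + k and k + k + k, as +_ commutes with addition definitionally.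
  R : ℕ → ℕ → ℤ
  R k x = tail k (pent k + x)

  private
    2k+1 : ∀ k → 2 * k + 1 ≡ suc (k + k)
    2k+1 = ℕSolver.solve-∀

    second-> : ∀ k y → (f ⊛ q^ (pent k + (2 * k + 1))) (pent k + (suc (k + k) + y)) ≡ f y
    second-> k y = trans
      (cong (f ⊛ q^ (pent k + (2 * k + 1))) (trans (sym (ℕ.+-assoc (pent k) (suc (k + k)) y))
        (cong (λ z → pent k + z + y) (sym (2k+1 k)))))
      (⊛-q^ f (pent k + (2 * k + 1)) y)

    next-zero : ∀ k x → x < k + k + k + 2 → tail (suc k) (pent k + x) ≡ 0ℤ
    next-zero k x x< = tail-< (suc k) (pent k + x)
      (subst (pent k + x <_) (sym (pent-suc k)) (ℕ.+-monoʳ-< (pent k) x<))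

    drop-0 : ∀ d {c} → c ≡ 0ℤ → d ℤ.- c ≡ d
    drop-0 d refl = ℤ.+-identityʳ d

    Δ : ℕ → PowerSeries
    Δ k n = (f ⊛ q^ (pent k)) n ℤ.- (f ⊛ q^ (pent k + (2 * k + 1))) n

  -- Past `pent k`, the three terms of `tail-suc` start at the offsets 0, 2k + 1 and 3k + 2 = pent
  -- (k + 1) - pent k. This lemma and the next two treat the ranges between these offsets.
  R-low : ∀ k x → x < suc (k + k) → R k x ≡ f x
  R-low k x x< = trans (tail-suc k (pent k + x)) (trans
    (drop-0 (Δ k (pent k + x)) (next-zero k x (ℕ.<-≤-trans x< (subst (suc (k + k) ≤_) (reorder k) (ℕ.m≤m+n _ (suc k))))))
    (trans (cong₂ ℤ._-_ (⊛-q^ f (pent k) x)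
             (⊛-q^-< f (pent k + (2 * k + 1)) (pent k + x)
               (ℕ.+-monoʳ-< (pent k) (subst (x <_) (sym (2k+1 k)) x<))))
           (ℤ.+-identityʳ (f x))))
    where
    reorder : ∀ k → suc (k + k) + suc k ≡ k + k + k + 2
    reorder = ℕSolver.solve-∀

  R-mid : ∀ k y → y ≤ k → R k (suc (k + k) + y) ≡ f (suc (k + k) + y) ℤ.- f y
  R-mid k y y≤k = trans (tail-suc k (pent k + (suc (k + k) + y))) (trans
    (drop-0 (Δ k (pent k + (suc (k + k) + y))) (next-zero k (suc (k + k) + y)
      (subst (suc (k + k) + y <_) (reorder k) (ℕ.+-monoʳ-< (suc (k + k)) (s≤s y≤k)))))
    (cong₂ ℤ._-_ (⊛-q^ f (pent k) _) (second-> k y)))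
    where
    reorder : ∀ k → suc (k + k) + suc k ≡ k + k + k + 2
    reorder = ℕSolver.solve-∀

  R-high : ∀ k y → R k (k + k + k + 2 + y) ≡ f (k + k + k + 2 + y) ℤ.- f (suc k + y) ℤ.- R (suc k) y
  R-high k y = trans (tail-suc k (pent k + (k + k + k + 2 + y))) (cong₂ ℤ._-_
    (cong₂ ℤ._-_ (⊛-q^ f (pent k) _)
      (trans (cong (λ z → (f ⊛ q^ (pent k + (2 * k + 1))) (pent k + z)) (reorder k y)) (second-> k (suc k + y))))
    (cong (tail (suc k)) (trans (sym (ℕ.+-assoc (pent k) _ y)) (cong (_+ y) (sym (pent-suc k))))))
    where
    reorder : ∀ k y → k + k + k + 2 + y ≡ suc (k + k) + (suc k + y)
    reorder = ℕSolver.solve-∀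

-- Lower bound for R

-- The cases that arise when the recursion is unfolded at most twice. One unfolding subtracts
-- `R (suc k)`, which would call for an upper bound; after two, `R (suc (suc k))` enters with a plus
-- sign and a lower bound alone propagates. The case `far` begins at x = 6k + 7.
data Region (k : ℕ) : ℕ → Set where
  low   : ∀ {x} → x ≤ k + k → Region k x
  mid   : ∀ {y} → y ≤ k → Region k (suc (k + k) + y)
  high  : ∀ {y} → y ≤ suc k + suc k → Region k (k + k + k + 2 + y)
  upper : ∀ {z} → z ≤ suc k → Region k (k + k + k + 2 + (suc (suc k + suc k) + z))
  far   : ∀ t → Region k (k + k + k + 2 + (suc k + suc k + suc k + 2 + t))

≤⊎> : ∀ m n → n ≤ m ⊎ ∃ λ o → n ≡ suc m + o
≤⊎> m n = case n ≤? m of λ where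
  (yes n≤m) → inj₁ n≤m
  (no n≰m)  → inj₂ (n ∸ suc m , sym (ℕ.m+[n∸m]≡n (ℕ.≰⇒> n≰m)))

region : ∀ k x → Region k x
region k x with ≤⊎> (k + k) x
... | inj₁ x≤ = low x≤
... | inj₂ (y , refl) with ≤⊎> k y
... | inj₁ y≤ = mid y≤
... | inj₂ (y′ , refl) = subst (Region k) (regroup k y′) (region′ (≤⊎> (suc k + suc k) y′))
  where
  regroup : ∀ k y → k + k + k + 2 + y ≡ suc (k + k) + (suc k + y)
  regroup = ℕSolver.solve-∀
  regroup′ : ∀ k t → suc k + suc k + suc k + 2 + t ≡ suc (suc k + suc k) + (suc (suc k) + t)
  regroup′ = ℕSolver.solve-∀
  region″ : ∀ {z} → z ≤ suc k ⊎ (∃ λ t → z ≡ suc (suc k) + t) →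
            Region k (k + k + k + 2 + (suc (suc k + suc k) + z))
  region″ (inj₁ z≤)         = upper z≤
  region″ (inj₂ (t , refl)) = subst (λ y → Region k (k + k + k + 2 + y)) (regroup′ k t) (far t)
  region′ : ∀ {y} → y ≤ suc k + suc k ⊎ (∃ λ z → y ≡ suc (suc k + suc k) + z) →
            Region k (k + k + k + 2 + y)
  region′ (inj₁ y≤)         = high y≤
  region′ (inj₂ (z , refl)) = region″ (≤⊎> (suc k) z)

-- Certificates of nonnegativity

infixl 6 _⊕_
infixl 7 _⊗_

_⊕_ : ∀ {i j} → 0ℤ ℤ.≤ i → 0ℤ ℤ.≤ j → 0ℤ ℤ.≤ i ℤ.+ j
_⊕_ = ℤ.+-mono-≤

_⊗_ : ∀ {i j} → 0ℤ ℤ.≤ i → 0ℤ ℤ.≤ j → 0ℤ ℤ.≤ i ℤ.* j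
_⊗_ {+ m} {+ n} _ _ = subst (0ℤ ℤ.≤_) (ℤ.pos-* m n) (ℤ.+≤+ z≤n)

sq : ∀ i → 0ℤ ℤ.≤ i ℤ.* i
sq (+ n)        = subst (0ℤ ℤ.≤_) (ℤ.pos-* n n) (ℤ.+≤+ z≤n)
sq ℤ.-[1+ n ]   = ℤ.+≤+ z≤n

nat : ∀ n → 0ℤ ℤ.≤ + n
nat n = ℤ.+≤+ z≤n

-- The form of the polynomial estimates below: the difference of the two sides is written as a sum
-- of visibly nonnegative terms, and the ring solver checks the identity.
≡+⇒≤ : ∀ {i j d} → 0ℤ ℤ.≤ d → j ≡ i ℤ.+ d → i ℤ.≤ j
≡+⇒≤ {i} {d = d} 0≤d refl = subst (ℤ._≤ i ℤ.+ d) (ℤ.+-identityʳ i) (ℤ.+-monoʳ-≤ i 0≤d)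

1≤⇒0< : ∀ {i} → 1ℤ ℤ.≤ i → 0ℤ ℤ.< i
1≤⇒0< = ℤ.suc[i]≤j⇒i<j

-- In terms of N = 2n + σ - 1, where n = k(3k+1)/2 + x, the exact solution for ρ = 0 is
-- k(N - 3k² + 3) = k(2x + k + σ + 2).  Adding (109-σ)k, where a + b ≤ 109 - σ, and subtracting
-- 2n + 3025 + a turns it into L.
L : ℤ → ℤ → ℤ → ℤ
L A K X = (K ℤ.+ K ℤ.- + 2) ℤ.* X ℤ.+ + 110 ℤ.* K ℤ.- + 2 ℤ.* (K ℤ.* K) ℤ.- + 3025 ℤ.- A

-- Here c = 2αβγ and h = σ/2, and `f-lower` and `f-upper` say that -a ≤ ρ ≤ b. The budget `small₁`
-- pays for ρ in each unfolding of the recursion; `small₂` absorbs the constants in several of the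
-- cases.
module Bound
  (f : ℕ → ℤ) (R : ℕ → ℕ → ℤ)
  (R-low  : ∀ k x → x < suc (k + k) → R k x ≡ f x)
  (R-mid  : ∀ k y → y ≤ k → R k (suc (k + k) + y) ≡ f (suc (k + k) + y) ℤ.- f y)
  (R-high : ∀ k y → R k (k + k + k + 2 + y) ≡ f (k + k + k + 2 + y) ℤ.- f (suc k + y) ℤ.- R (suc k) y)
  (c h a b : ℕ)
  (f-lower : ∀ m → 0ℤ ℤ.≤ + c ℤ.* f m ℤ.- (+ m ℤ.+ + h) ℤ.* (+ m ℤ.+ + h) ℤ.+ + a)
  (f-upper : ∀ m → 0ℤ ℤ.≤ (+ m ℤ.+ + h) ℤ.* (+ m ℤ.+ + h) ℤ.+ + b ℤ.- + c ℤ.* f m)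
  (small₁ : 0ℤ ℤ.≤ + 109 ℤ.- (+ a ℤ.+ + b ℤ.+ (+ h ℤ.+ + h)))
  (small₂ : 0ℤ ℤ.≤ + 200 ℤ.- (+ h ℤ.* + h ℤ.+ (+ h ℤ.+ + h) ℤ.+ + a ℤ.+ (+ b ℤ.+ + b)))
  where

  R-high-via : ∀ k y {r} → R (suc k) y ≡ r →
    R k (k + k + k + 2 + y) ≡ f (k + k + k + 2 + y) ℤ.- f (suc k + y) ℤ.- r
  R-high-via k y refl = R-high k y

  R-high-low : ∀ k y → y ≤ suc k + suc k →
    R k (k + k + k + 2 + y) ≡ f (k + k + k + 2 + y) ℤ.- f (suc k + y) ℤ.- f y
  R-high-low k y y≤ = R-high-via k y (R-low (suc k) y (s≤s y≤))

  R-high-mid : ∀ k z → z ≤ suc k → let y = suc (suc k + suc k) + z in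
    R k (k + k + k + 2 + y) ≡ f (k + k + k + 2 + y) ℤ.- f (suc k + y) ℤ.- (f y ℤ.- f z)
  R-high-mid k z z≤ = R-high-via k _ (R-mid (suc k) z z≤)

  R-high-high : ∀ k t → let y = suc k + suc k + suc k + 2 + t in
    R k (k + k + k + 2 + y) ≡
    f (k + k + k + 2 + y) ℤ.- f (suc k + y) ℤ.- (f y ℤ.- f (suc (suc k) + t) ℤ.- R (suc (suc k)) t)
  R-high-high k t = R-high-via k _ (R-high (suc k) t)

  0≤n-m : ∀ {m n} → m ≤ n → 0ℤ ℤ.≤ + n ℤ.- + m
  0≤n-m m≤n = ℤ.i≤j⇒0≤j-i (ℤ.+≤+ m≤n)

  bound-low : ∀ k x → L (+ a) (+ k) (+ x) ℤ.≤ + c ℤ.* f x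
  bound-low k x = ≡+⇒≤
    -- As 110 = 2·55 and 3025 = 55², the terms of `L` in k complete the square (k - 55)².
    (sq (+ x ℤ.- + k) ⊕ sq (+ k ℤ.- + 55) ⊕ (nat h ⊕ nat 1) ⊗ (nat x ⊕ nat x) ⊕ sq (+ h) ⊕ f-lower x)
    (identity (+ k) (+ x) (+ h) (+ a) (+ c) (f x))
    where
    identity : ∀ K X h a c fx → c ℤ.* fx ≡
      ((K ℤ.+ K ℤ.- + 2) ℤ.* X ℤ.+ + 110 ℤ.* K ℤ.- + 2 ℤ.* (K ℤ.* K) ℤ.- + 3025 ℤ.- a) ℤ.+
      ((X ℤ.- K) ℤ.* (X ℤ.- K) ℤ.+ (K ℤ.- + 55) ℤ.* (K ℤ.- + 55) ℤ.+ (h ℤ.+ + 1) ℤ.* (X ℤ.+ X) ℤ.+ h ℤ.* h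
       ℤ.+ (c ℤ.* fx ℤ.- (X ℤ.+ h) ℤ.* (X ℤ.+ h) ℤ.+ a))
    identity = solve-∀

  bound-mid : ∀ k y → L (+ a) (+ k) (+ (suc (k + k) + y)) ℤ.≤ + c ℤ.* (f (suc (k + k) + y) ℤ.- f y)
  bound-mid k y = ≡+⇒≤
    -- The squares contribute (x + h)² - (y + h)² = (2k + 1)(2k + 1 + 2y + 2h). After subtraction of
    -- `L`, the part in k alone is 2k² - 104k, completed to 2(k - 26)².
    (nat 2 ⊗ sq (+ k ℤ.- + 26) ⊕ nat 2 ⊗ (nat k ⊗ nat y) ⊕ nat 4 ⊗ nat y ⊕ nat 4 ⊗ (nat k ⊗ nat h) ⊕ nat 4 ⊗ nat h
      ⊕ nat 1476 ⊕ nat h ⊗ nat h ⊕ nat a ⊕ nat b ⊕ small₂ ⊕ f-lower (suc (k + k) + y) ⊕ f-upper y)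
    (identity (+ k) (+ y) (+ h) (+ a) (+ b) (+ c) (f (suc (k + k) + y)) (f y))
    where
    identity : ∀ K Y h a b c fx fy → let X = + 1 ℤ.+ (K ℤ.+ K) ℤ.+ Y in c ℤ.* (fx ℤ.- fy) ≡
      ((K ℤ.+ K ℤ.- + 2) ℤ.* X ℤ.+ + 110 ℤ.* K ℤ.- + 2 ℤ.* (K ℤ.* K) ℤ.- + 3025 ℤ.- a) ℤ.+
      (+ 2 ℤ.* ((K ℤ.- + 26) ℤ.* (K ℤ.- + 26)) ℤ.+ + 2 ℤ.* (K ℤ.* Y) ℤ.+ + 4 ℤ.* Y ℤ.+ + 4 ℤ.* (K ℤ.* h) ℤ.+ + 4 ℤ.* h
       ℤ.+ + 1476 ℤ.+ h ℤ.* h ℤ.+ a ℤ.+ b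
       ℤ.+ (+ 200 ℤ.- (h ℤ.* h ℤ.+ (h ℤ.+ h) ℤ.+ a ℤ.+ (b ℤ.+ b)))
       ℤ.+ (c ℤ.* fx ℤ.- (X ℤ.+ h) ℤ.* (X ℤ.+ h) ℤ.+ a)
       ℤ.+ ((Y ℤ.+ h) ℤ.* (Y ℤ.+ h) ℤ.+ b ℤ.- c ℤ.* fy))
    identity = solve-∀

  bound-high : ∀ k y → y ≤ suc k + suc k → let x = k + k + k + 2 + y; x′ = suc k + y in
    L (+ a) (+ k) (+ x) ℤ.≤ + c ℤ.* (f x ℤ.- f x′ ℤ.- f y)
  bound-high k y y≤ = ≡+⇒≤
    -- The upper limit on y absorbs the subtracted (y + h)², through the terms y(2k + 2 - y) and
    -- 2h(2k + 2 - y).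
    (sq (+ 2 ℤ.* + k ℤ.- + 25) ⊕ nat 2 ⊗ nat k ⊕ nat y ⊗ 0≤n-m y≤ ⊕ nat 2 ⊗ nat y ⊕ nat 2 ⊗ nat h ⊗ 0≤n-m y≤
      ⊕ nat 2207 ⊕ nat a ⊕ small₂ ⊕ f-lower (k + k + k + 2 + y) ⊕ f-upper (suc k + y) ⊕ f-upper y)
    (identity (+ k) (+ y) (+ h) (+ a) (+ b) (+ c) (f (k + k + k + 2 + y)) (f (suc k + y)) (f y))
    where
    identity : ∀ K Y h a b c fx fx′ fy →
      let X = K ℤ.+ K ℤ.+ K ℤ.+ + 2 ℤ.+ Y ; X′ = + 1 ℤ.+ K ℤ.+ Y ; U = (+ 1 ℤ.+ K ℤ.+ (+ 1 ℤ.+ K)) ℤ.- Y in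
      c ℤ.* (fx ℤ.- fx′ ℤ.- fy) ≡
      ((K ℤ.+ K ℤ.- + 2) ℤ.* X ℤ.+ + 110 ℤ.* K ℤ.- + 2 ℤ.* (K ℤ.* K) ℤ.- + 3025 ℤ.- a) ℤ.+
      ((+ 2 ℤ.* K ℤ.- + 25) ℤ.* (+ 2 ℤ.* K ℤ.- + 25) ℤ.+ + 2 ℤ.* K ℤ.+ Y ℤ.* U ℤ.+ + 2 ℤ.* Y ℤ.+ + 2 ℤ.* h ℤ.* U
       ℤ.+ + 2207 ℤ.+ a
       ℤ.+ (+ 200 ℤ.- (h ℤ.* h ℤ.+ (h ℤ.+ h) ℤ.+ a ℤ.+ (b ℤ.+ b)))
       ℤ.+ (c ℤ.* fx ℤ.- (X ℤ.+ h) ℤ.* (X ℤ.+ h) ℤ.+ a)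
       ℤ.+ ((X′ ℤ.+ h) ℤ.* (X′ ℤ.+ h) ℤ.+ b ℤ.- c ℤ.* fx′)
       ℤ.+ ((Y ℤ.+ h) ℤ.* (Y ℤ.+ h) ℤ.+ b ℤ.- c ℤ.* fy))
    identity = solve-∀

  bound-upper : ∀ k z → z ≤ suc k →
    let y = suc (suc k + suc k) + z; x = k + k + k + 2 + y; x′ = suc k + y in
    L (+ a) (+ k) (+ x) ℤ.≤ + c ℤ.* (f x ℤ.- f x′ ℤ.- (f y ℤ.- f z))
  bound-upper k z z≤ = ≡+⇒≤
    (nat 2 ⊗ sq (+ k ℤ.- + 25) ⊕ nat 2 ⊗ 0≤n-m z≤ ⊗ nat (suc k) ⊕ nat 1565 ⊕ nat a ⊕ small₁ ⊕ small₁
      ⊕ f-lower (k + k + k + 2 + y) ⊕ f-upper (suc k + y) ⊕ f-upper y ⊕ f-lower z)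
    (identity (+ k) (+ z) (+ h) (+ a) (+ b) (+ c) (f (k + k + k + 2 + y)) (f (suc k + y)) (f y) (f z))
    where
    y = suc (suc k + suc k) + z
    identity : ∀ K Z h a b c fx fx′ fy fz →
      let Y = + 1 ℤ.+ (+ 1 ℤ.+ K ℤ.+ (+ 1 ℤ.+ K)) ℤ.+ Z ; X = K ℤ.+ K ℤ.+ K ℤ.+ + 2 ℤ.+ Y ; X′ = + 1 ℤ.+ K ℤ.+ Y
          E = + 109 ℤ.- (a ℤ.+ b ℤ.+ (h ℤ.+ h)) in
      c ℤ.* (fx ℤ.- fx′ ℤ.- (fy ℤ.- fz)) ≡
      ((K ℤ.+ K ℤ.- + 2) ℤ.* X ℤ.+ + 110 ℤ.* K ℤ.- + 2 ℤ.* (K ℤ.* K) ℤ.- + 3025 ℤ.- a) ℤ.+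
      (+ 2 ℤ.* ((K ℤ.- + 25) ℤ.* (K ℤ.- + 25)) ℤ.+ + 2 ℤ.* (+ 1 ℤ.+ K ℤ.- Z) ℤ.* (+ 1 ℤ.+ K) ℤ.+ + 1565 ℤ.+ a ℤ.+ E ℤ.+ E
       ℤ.+ (c ℤ.* fx ℤ.- (X ℤ.+ h) ℤ.* (X ℤ.+ h) ℤ.+ a)
       ℤ.+ ((X′ ℤ.+ h) ℤ.* (X′ ℤ.+ h) ℤ.+ b ℤ.- c ℤ.* fx′)
       ℤ.+ ((Y ℤ.+ h) ℤ.* (Y ℤ.+ h) ℤ.+ b ℤ.- c ℤ.* fy)
       ℤ.+ (c ℤ.* fz ℤ.- (Z ℤ.+ h) ℤ.* (Z ℤ.+ h) ℤ.+ a))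
    identity = solve-∀

  -- The four squares (m + h)², taken with their signs, exceed L(k, x) - L(k + 2, t) by exactly
  -- 2(109 - 2h). By `small₁` this pays for the error 2a + 2b of the four values of f.
  bound-far : ∀ k t r → L (+ a) (+ suc (suc k)) (+ t) ℤ.≤ + c ℤ.* r →
    let y = suc k + suc k + suc k + 2 + t; x = k + k + k + 2 + y; x′ = suc k + y; y′ = suc (suc k) + t in
    L (+ a) (+ k) (+ x) ℤ.≤ + c ℤ.* (f x ℤ.- f x′ ℤ.- (f y ℤ.- f y′ ℤ.- r))
  bound-far k t r L≤ = ≡+⇒≤
    (ℤ.i≤j⇒0≤j-i L≤ ⊕ small₁ ⊕ small₁
      ⊕ f-lower (k + k + k + 2 + y) ⊕ f-upper (suc k + y) ⊕ f-upper y ⊕ f-lower (suc (suc k) + t))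
    (identity (+ k) (+ t) (+ h) (+ a) (+ b) (+ c) (f (k + k + k + 2 + y)) (f (suc k + y)) (f y) (f (suc (suc k) + t)) r)
    where
    y = suc k + suc k + suc k + 2 + t
    identity : ∀ K T h a b c fx fx′ fy fy′ r →
      let Y = + 1 ℤ.+ K ℤ.+ (+ 1 ℤ.+ K) ℤ.+ (+ 1 ℤ.+ K) ℤ.+ + 2 ℤ.+ T ; X = K ℤ.+ K ℤ.+ K ℤ.+ + 2 ℤ.+ Y
          X′ = + 1 ℤ.+ K ℤ.+ Y ; Y′ = + 2 ℤ.+ K ℤ.+ T ; K′ = + 2 ℤ.+ K
          E = + 109 ℤ.- (a ℤ.+ b ℤ.+ (h ℤ.+ h)) in
      c ℤ.* (fx ℤ.- fx′ ℤ.- (fy ℤ.- fy′ ℤ.- r)) ≡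
      ((K ℤ.+ K ℤ.- + 2) ℤ.* X ℤ.+ + 110 ℤ.* K ℤ.- + 2 ℤ.* (K ℤ.* K) ℤ.- + 3025 ℤ.- a) ℤ.+
      (c ℤ.* r ℤ.- ((K′ ℤ.+ K′ ℤ.- + 2) ℤ.* T ℤ.+ + 110 ℤ.* K′ ℤ.- + 2 ℤ.* (K′ ℤ.* K′) ℤ.- + 3025 ℤ.- a)
       ℤ.+ E ℤ.+ E
       ℤ.+ (c ℤ.* fx ℤ.- (X ℤ.+ h) ℤ.* (X ℤ.+ h) ℤ.+ a)
       ℤ.+ ((X′ ℤ.+ h) ℤ.* (X′ ℤ.+ h) ℤ.+ b ℤ.- c ℤ.* fx′)
       ℤ.+ ((Y ℤ.+ h) ℤ.* (Y ℤ.+ h) ℤ.+ b ℤ.- c ℤ.* fy)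
       ℤ.+ (c ℤ.* fy′ ℤ.- (Y′ ℤ.+ h) ℤ.* (Y′ ℤ.+ h) ℤ.+ a))
    identity = solve-∀

  bound : ∀ k x → L (+ a) (+ k) (+ x) ℤ.≤ + c ℤ.* R k x
  bound k x = go (suc x) k x ℕ.≤-refl
    where
    -- The recursion is on a strict upper bound `n` of `x`: the call in the case `far` raises k by 2
    -- but lowers x.
    go : ∀ n k x → x < n → L (+ a) (+ k) (+ x) ℤ.≤ + c ℤ.* R k x
    step : ∀ n k {x} → x ≤ n → Region k x → L (+ a) (+ k) (+ x) ℤ.≤ + c ℤ.* R k x
    go (suc n) k x (s≤s x≤n) = step n k x≤n (region k x)
    step n k x≤n (low {x} x≤) = subst (λ r → _ ℤ.≤ + c ℤ.* r) (sym (R-low k x (s≤s x≤))) (bound-low k x)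
    step n k x≤n (mid {y} y≤) = subst (λ r → _ ℤ.≤ + c ℤ.* r) (sym (R-mid k y y≤)) (bound-mid k y)
    step n k x≤n (high {y} y≤) = subst (λ r → _ ℤ.≤ + c ℤ.* r) (sym (R-high-low k y y≤)) (bound-high k y y≤)
    step n k x≤n (upper {z} z≤) = subst (λ r → _ ℤ.≤ + c ℤ.* r) (sym (R-high-mid k z z≤)) (bound-upper k z z≤)
    step n k x≤n (far t) = subst (λ r → _ ℤ.≤ + c ℤ.* r) (sym (R-high-high k t))
      (bound-far k t _ (go n (suc (suc k)) t (ℕ.<-≤-trans (decrease k t) x≤n)))
      where
      decrease : ∀ k t → t < k + k + k + 2 + (suc k + suc k + suc k + 2 + t)
      decrease k t = subst (t <_) (regroup k t) (s≤s (ℕ.m≤n+m t (6 * k + 6)))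
        where
        regroup : ∀ k t → suc (6 * k + 6 + t) ≡ k + k + k + 2 + (suc k + suc k + suc k + 2 + t)
        regroup = ℕSolver.solve-∀

  -- Positivity of R

  cancel-c : ∀ {r} → 0ℤ ℤ.< + c ℤ.* r → 0ℤ ℤ.< r
  cancel-c {r} 0<cr = ℤ.*-cancelˡ-<-nonNeg (+ c) (subst (ℤ._< + c ℤ.* r) (sym (ℤ.*-zeroʳ (+ c))) 0<cr)

  -- `L` is affine in x with slope 2(k - 1) = 2i ≥ 0, so positivity at one x persists.
  positive-beyond : ∀ i x → 0ℤ ℤ.< L (+ a) (+ suc i) (+ x) → ∀ t → 0ℤ ℤ.< R (suc i) (x + t)
  positive-beyond i x 0<L t = cancel-c (ℤ.<-≤-trans 0<L (ℤ.≤-trans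
    (≡+⇒≤ (nat 2 ⊗ nat i ⊗ nat t) (identity (+ i) (+ x) (+ t) (+ a))) (bound (suc i) (x + t))))
    where
    identity : ∀ I X T a → let K = + 1 ℤ.+ I in
      ((K ℤ.+ K ℤ.- + 2) ℤ.* (X ℤ.+ T) ℤ.+ + 110 ℤ.* K ℤ.- + 2 ℤ.* (K ℤ.* K) ℤ.- + 3025 ℤ.- a) ≡
      ((K ℤ.+ K ℤ.- + 2) ℤ.* X ℤ.+ + 110 ℤ.* K ℤ.- + 2 ℤ.* (K ℤ.* K) ℤ.- + 3025 ℤ.- a) ℤ.+ + 2 ℤ.* I ℤ.* T
    identity = solve-∀

  positive-mid : ∀ i y → let k = 14 + i in 0ℤ ℤ.< f (suc (k + k) + y) ℤ.- f y
  positive-mid i y = cancel-c (1≤⇒0< (≡+⇒≤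
    -- These terms come from (2k + 1)² = 4i² + 116i + 841, where 841 = 1 + 731 + 109 and the 109
    -- covers a + b + 2h.
    (nat 4 ⊗ (nat i ⊗ nat i) ⊕ nat 116 ⊗ nat i ⊕ nat 731 ⊕ small₁ ⊕ nat 2 ⊗ nat h
      ⊕ nat (suc (k + k)) ⊗ (nat 2 ⊗ nat y ⊕ nat 2 ⊗ nat h) ⊕ f-lower (suc (k + k) + y) ⊕ f-upper y)
    (identity (+ i) (+ y) (+ h) (+ a) (+ b) (+ c) (f (suc (k + k) + y)) (f y))))
    where
    k = 14 + i
    identity : ∀ I Y h a b c fx fy → let K = + 14 ℤ.+ I ; X = + 1 ℤ.+ (K ℤ.+ K) ℤ.+ Y in c ℤ.* (fx ℤ.- fy) ≡
      + 1 ℤ.+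
      (+ 4 ℤ.* (I ℤ.* I) ℤ.+ + 116 ℤ.* I ℤ.+ + 731 ℤ.+ (+ 109 ℤ.- (a ℤ.+ b ℤ.+ (h ℤ.+ h))) ℤ.+ + 2 ℤ.* h
       ℤ.+ (+ 1 ℤ.+ (K ℤ.+ K)) ℤ.* (+ 2 ℤ.* Y ℤ.+ + 2 ℤ.* h)
       ℤ.+ (c ℤ.* fx ℤ.- (X ℤ.+ h) ℤ.* (X ℤ.+ h) ℤ.+ a)
       ℤ.+ ((Y ℤ.+ h) ℤ.* (Y ℤ.+ h) ℤ.+ b ℤ.- c ℤ.* fy))
    identity = solve-∀

  positive-high : ∀ i y → let k = 14 + i; x = k + k + k + 2 + y; x′ = suc k + y in
    y ≤ suc k + suc k → 0ℤ ℤ.< f x ℤ.- f x′ ℤ.- f y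
  positive-high i y y≤ = cancel-c (1≤⇒0< (≡+⇒≤
    -- Here 8k² + 3 = 8i² + 224i + 1571, and 1571 = 1 + 1370 + 200 leaves 200 for `small₂`.
    (nat 8 ⊗ (nat i ⊗ nat i) ⊕ nat 224 ⊗ nat i ⊕ nat 1370 ⊕ nat 10 ⊗ nat k ⊕ nat 2 ⊗ (nat k ⊗ nat y)
      ⊕ nat y ⊗ 0≤n-m y≤ ⊕ nat 2 ⊗ nat h ⊗ 0≤n-m y≤
      ⊕ small₂ ⊕ f-lower (k + k + k + 2 + y) ⊕ f-upper (suc k + y) ⊕ f-upper y)
    (identity (+ i) (+ y) (+ h) (+ a) (+ b) (+ c) (f (k + k + k + 2 + y)) (f (suc k + y)) (f y))))
    where
    k = 14 + i
    identity : ∀ I Y h a b c fx fx′ fy → let K = + 14 ℤ.+ I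
                                             X = K ℤ.+ K ℤ.+ K ℤ.+ + 2 ℤ.+ Y ; X′ = + 1 ℤ.+ K ℤ.+ Y
                                             U = (+ 1 ℤ.+ K ℤ.+ (+ 1 ℤ.+ K)) ℤ.- Y in
      c ℤ.* (fx ℤ.- fx′ ℤ.- fy) ≡
      + 1 ℤ.+
      (+ 8 ℤ.* (I ℤ.* I) ℤ.+ + 224 ℤ.* I ℤ.+ + 1370 ℤ.+ + 10 ℤ.* K ℤ.+ + 2 ℤ.* (K ℤ.* Y) ℤ.+ Y ℤ.* U ℤ.+ + 2 ℤ.* h ℤ.* U
       ℤ.+ (+ 200 ℤ.- (h ℤ.* h ℤ.+ (h ℤ.+ h) ℤ.+ a ℤ.+ (b ℤ.+ b)))
       ℤ.+ (c ℤ.* fx ℤ.- (X ℤ.+ h) ℤ.* (X ℤ.+ h) ℤ.+ a)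
       ℤ.+ ((X′ ℤ.+ h) ℤ.* (X′ ℤ.+ h) ℤ.+ b ℤ.- c ℤ.* fx′)
       ℤ.+ ((Y ℤ.+ h) ℤ.* (Y ℤ.+ h) ℤ.+ b ℤ.- c ℤ.* fy))
    identity = solve-∀

  positive-upper : ∀ i z → let k = 14 + i; y = suc (suc k + suc k) + z; x = k + k + k + 2 + y; x′ = suc k + y in
    z ≤ suc k → 0ℤ ℤ.< f x ℤ.- f x′ ℤ.- (f y ℤ.- f z)
  positive-upper i z z≤ = cancel-c (1≤⇒0< (≡+⇒≤
    (nat 12 ⊗ (nat i ⊗ nat i) ⊕ nat 336 ⊗ nat i ⊕ nat 2129 ⊕ nat 10 ⊗ nat k ⊕ nat 4 ⊗ 0≤n-m z≤ ⊕ small₁ ⊕ small₁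
      ⊕ f-lower (k + k + k + 2 + y) ⊕ f-upper (suc k + y) ⊕ f-upper y ⊕ f-lower z)
    (identity (+ i) (+ z) (+ h) (+ a) (+ b) (+ c) (f (k + k + k + 2 + y)) (f (suc k + y)) (f y) (f z))))
    where
    k = 14 + i
    y = suc (suc k + suc k) + z
    identity : ∀ I Z h a b c fx fx′ fy fz →
      let K = + 14 ℤ.+ I
          Y = + 1 ℤ.+ (+ 1 ℤ.+ K ℤ.+ (+ 1 ℤ.+ K)) ℤ.+ Z ; X = K ℤ.+ K ℤ.+ K ℤ.+ + 2 ℤ.+ Y ; X′ = + 1 ℤ.+ K ℤ.+ Y
          E = + 109 ℤ.- (a ℤ.+ b ℤ.+ (h ℤ.+ h)) in
      c ℤ.* (fx ℤ.- fx′ ℤ.- (fy ℤ.- fz)) ≡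
      + 1 ℤ.+
      (+ 12 ℤ.* (I ℤ.* I) ℤ.+ + 336 ℤ.* I ℤ.+ + 2129 ℤ.+ + 10 ℤ.* K ℤ.+ + 4 ℤ.* (+ 1 ℤ.+ K ℤ.- Z) ℤ.+ E ℤ.+ E
       ℤ.+ (c ℤ.* fx ℤ.- (X ℤ.+ h) ℤ.* (X ℤ.+ h) ℤ.+ a)
       ℤ.+ ((X′ ℤ.+ h) ℤ.* (X′ ℤ.+ h) ℤ.+ b ℤ.- c ℤ.* fx′)
       ℤ.+ ((Y ℤ.+ h) ℤ.* (Y ℤ.+ h) ℤ.+ b ℤ.- c ℤ.* fy)
       ℤ.+ (c ℤ.* fz ℤ.- (Z ℤ.+ h) ℤ.* (Z ℤ.+ h) ℤ.+ a))
    identity = solve-∀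

  positive-far : ∀ i t → let k = 14 + i in
    0ℤ ℤ.< R k (k + k + k + 2 + (suc k + suc k + suc k + 2 + t))
  positive-far i t = cancel-c (1≤⇒0< (ℤ.≤-trans (≡+⇒≤
    -- At x = 6k + 7, `L` equals 10k² + 112k - 3039 - a. For k = 14 this is 489 - a, and `small₂`
    -- gives a ≤ 200.
    (nat 10 ⊗ (nat i ⊗ nat i) ⊕ nat 392 ⊗ nat i ⊕ nat 288 ⊕ (nat 26 ⊕ nat 2 ⊗ nat i) ⊗ nat t
      ⊕ small₂ ⊕ nat h ⊗ nat h ⊕ nat 2 ⊗ nat h ⊕ nat 2 ⊗ nat b)
    (identity (+ i) (+ t) (+ h) (+ a) (+ b)))
    (bound k (k + k + k + 2 + (suc k + suc k + suc k + 2 + t)))))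
    where
    k = 14 + i
    identity : ∀ I T h a b →
      let K = + 14 ℤ.+ I
          X = K ℤ.+ K ℤ.+ K ℤ.+ + 2 ℤ.+ (+ 1 ℤ.+ K ℤ.+ (+ 1 ℤ.+ K) ℤ.+ (+ 1 ℤ.+ K) ℤ.+ + 2 ℤ.+ T) in
      ((K ℤ.+ K ℤ.- + 2) ℤ.* X ℤ.+ + 110 ℤ.* K ℤ.- + 2 ℤ.* (K ℤ.* K) ℤ.- + 3025 ℤ.- a) ≡
      + 1 ℤ.+
      (+ 10 ℤ.* (I ℤ.* I) ℤ.+ + 392 ℤ.* I ℤ.+ + 288 ℤ.+ (+ 26 ℤ.+ + 2 ℤ.* I) ℤ.* T
       ℤ.+ (+ 200 ℤ.- (h ℤ.* h ℤ.+ (h ℤ.+ h) ℤ.+ a ℤ.+ (b ℤ.+ b))) ℤ.+ h ℤ.* h ℤ.+ + 2 ℤ.* h ℤ.+ + 2 ℤ.* b)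
    identity = solve-∀

  -- For x ≤ 2k nothing is subtracted from f x, which may itself vanish, so this case is left to the
  -- values of f.
  positive-or-initial : ∀ i x → let k = 14 + i in 0ℤ ℤ.< R k x ⊎ R k x ≡ f x
  positive-or-initial i x = from (region k x)
    where
    k = 14 + i
    from : ∀ {x} → Region k x → 0ℤ ℤ.< R k x ⊎ R k x ≡ f x
    from (low x≤)       = inj₂ (R-low k _ (s≤s x≤))
    from (mid {y} y≤)   = inj₁ (subst (0ℤ ℤ.<_) (sym (R-mid k y y≤)) (positive-mid i y))
    from (high {y} y≤)  = inj₁ (subst (0ℤ ℤ.<_) (sym (R-high-low k y y≤)) (positive-high i y y≤))
    from (upper {z} z≤) = inj₁ (subst (0ℤ ℤ.<_) (sym (R-high-mid k z z≤)) (positive-upper i z z≤))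
    from (far t)        = inj₁ (positive-far i t)

-- Finite verification

step-induction : ∀ (P : ℕ → Set) d .{{_ : NonZero d}} →
  (∀ {n} → n < d → P n) → (∀ n → P n → P (n + d)) → ∀ n → P n
step-induction P d base step n =
  subst P (sym (m≡m%n+[m/n]*n n d)) (go (n / d))
  where
  regroup : ∀ r d m → r + m + d ≡ r + (d + m)
  regroup = ℕSolver.solve-∀
  go : ∀ q → P (n % d + q * d)
  go zero    = subst P (sym (ℕ.+-identityʳ (n % d))) (base (m%n<n n d))
  go (suc q) = subst P (regroup (n % d) d (q * d)) (step (n % d + q * d) (go q))

-- By `⊛-geometric-+`, the increment g (n + D) - g n grows by s·a when n grows by a. It therefore
-- equals t + s·n everywhere once it does so for n < a.
⊛-geometric-quasiperiodic : ∀ f a .{{_ : NonZero a}} D s t → let g = f ⊛ 1/[1-q^ a ] in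
  (∀ n → f (n + D) ≡ f n ℤ.+ s ℤ.* + a) →
  (∀ {n} → n < a → g (n + D) ≡ g n ℤ.+ (t ℤ.+ s ℤ.* + n)) →
  ∀ n → g (n + D) ≡ g n ℤ.+ (t ℤ.+ s ℤ.* + n)
⊛-geometric-quasiperiodic f a D s t f-step base = step-induction _ a base step
  where
  g = f ⊛ 1/[1-q^ a ]
  swap : ∀ n a D → n + a + D ≡ n + D + a
  swap = ℕSolver.solve-∀
  regroup : ∀ G F s t N A → (G ℤ.+ (t ℤ.+ s ℤ.* N)) ℤ.+ (F ℤ.+ s ℤ.* A) ≡ (G ℤ.+ F) ℤ.+ (t ℤ.+ s ℤ.* (N ℤ.+ A))
  regroup = solve-∀
  step : ∀ n → g (n + D) ≡ g n ℤ.+ (t ℤ.+ s ℤ.* + n) → g (n + a + D) ≡ g (n + a) ℤ.+ (t ℤ.+ s ℤ.* + (n + a))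
  step n ih = begin
    g (n + a + D)                                              ≡⟨ cong g (swap n a D) ⟩
    g (n + D + a)                                              ≡⟨ ⊛-geometric-+ f a (n + D) ⟩
    g (n + D) ℤ.+ f (n + D + a)                                ≡⟨ cong₂ ℤ._+_ ih (trans (cong f (sym (swap n a D))) (f-step (n + a))) ⟩
    (g n ℤ.+ (t ℤ.+ s ℤ.* + n)) ℤ.+ (f (n + a) ℤ.+ s ℤ.* + a)  ≡⟨ regroup (g n) (f (n + a)) s t (+ n) (+ a) ⟩
    (g n ℤ.+ f (n + a)) ℤ.+ (t ℤ.+ s ℤ.* + (n + a))            ≡⟨ cong (ℤ._+ _) (⊛-geometric-+ f a n) ⟨
    g (n + a) ℤ.+ (t ℤ.+ s ℤ.* + (n + a))                      ∎
    where open ≡-Reasoning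

does-true : ∀ {A : Set} (A? : Dec A) → does A? ≡ true → A
does-true (yes x) _ = x

positive-or? : ∀ {A : Set} v → Dec A → Dec (0ℤ ℤ.< v ⊎ (v ≡ 0ℤ × A))
positive-or? v A? = 0ℤ ℤ.<? v ⊎-dec (v ℤ.≟ 0ℤ ×-dec A?)

if-elim : ∀ b {u v w : ℤ} → (b ≡ true → u ≡ w) → (b ≡ false → v ≡ w) → (if b then u else v) ≡ w
if-elim true  p q = p refl
if-elim false p q = q refl

nth : List ℕ → ℕ → ℕ
nth []       _       = 0
nth (x ∷ xs) zero    = x
nth (x ∷ xs) (suc i) = nth xs i

module Fast (H h : ℕ) .{{_ : NonZero (H + H)}} (table : List ℕ) where

  -- The increments H + h + r + 2Hi over i < q add up to q(r + Hq + h). This closed form spares the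
  -- finite checks the convolutions.
  fast : ℕ → ℕ
  fast m = let r = m % (H + H); q = m / (H + H) in nth table r + q * (r + H * q + h)

  -- The first argument is fuel. If it exceeds x, the default 0 is never reached, because each call
  -- lowers x.
  R-fast : ℕ → ℕ → ℕ → ℤ
  R-fast zero    k x = 0ℤ
  R-fast (suc n) k x =
    if x <ᵇ suc (k + k) then + fast x
    else if x <ᵇ k + k + k + 2 then + fast x ℤ.- + fast (x ∸ suc (k + k))
    else + fast x ℤ.- + fast (x ∸ suc (k + k)) ℤ.- R-fast n (suc k) (x ∸ (k + k + k + 2))

module Verdict
  (f : ℕ → ℤ) (R : ℕ → ℕ → ℤ)
  (R-low  : ∀ k x → x < suc (k + k) → R k x ≡ f x)
  (R-mid  : ∀ k y → y ≤ k → R k (suc (k + k) + y) ≡ f (suc (k + k) + y) ℤ.- f y)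
  (R-high : ∀ k y → R k (k + k + k + 2 + y) ≡ f (k + k + k + 2 + y) ℤ.- f (suc k + y) ℤ.- R (suc k) y)
  (H h a b : ℕ) .{{_ : NonZero (H + H)}} (table : List ℕ) (zeros : ℕ → List ℕ)
  (f-initial : ∀ {n} → n < H + H → f n ≡ + nth table n)
  (f-period : ∀ n → f (n + (H + H)) ≡ f n ℤ.+ (+ (H + h) ℤ.+ 1ℤ ℤ.* + n))
  where

  open Fast H h table

  D : ℕ
  D = H + H

  c : ℕ
  c = D + D

  -- With k = 2 + i this is 1500/(k - 1). From there on, 2(k - 1)x is about 3000 or more and,
  -- together with 110k - 2k², is to outweigh 3025 + a; `beyond?` tests this.
  limit : ℕ → ℕ
  limit i = 1500 / suc i

  f-fast : ∀ m → f m ≡ + fast m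
  f-fast m = trans (cong f (m≡m%n+[m/n]*n m D)) (trans (go (m / D))
    (cong (λ v → v ℤ.+ + (m / D * (m % D + H * (m / D) + h))) (f-initial (m%n<n m D))))
    where
    r = m % D
    regroup : ∀ r D m → r + (D + m) ≡ r + m + D
    regroup = ℕSolver.solve-∀
    closed : ∀ q r H h → q * (r + H * q + h) + (H + h + (r + q * (H + H))) ≡ suc q * (r + H * suc q + h)
    closed = ℕSolver.solve-∀
    go : ∀ q → f (r + q * D) ≡ f r ℤ.+ + (q * (r + H * q + h))
    go zero    = trans (cong f (ℕ.+-identityʳ r)) (sym (ℤ.+-identityʳ (f r)))
    go (suc q) = begin
      f (r + suc q * D)                                  ≡⟨ cong f (regroup r D (q * D)) ⟩
      f (r + q * D + D)                                  ≡⟨ f-period (r + q * D) ⟩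
      f (r + q * D) ℤ.+ (+ (H + h) ℤ.+ 1ℤ ℤ.* + (r + q * D))
        ≡⟨ cong₂ ℤ._+_ (go q) (cong (λ v → + (H + h) ℤ.+ v) (ℤ.*-identityˡ (+ (r + q * D)))) ⟩
      f r ℤ.+ + (q * (r + H * q + h)) ℤ.+ + (H + h + (r + q * D))
        ≡⟨ ℤ.+-assoc (f r) (+ (q * (r + H * q + h))) (+ (H + h + (r + q * D))) ⟩
      f r ℤ.+ + (q * (r + H * q + h) + (H + h + (r + q * D)))
        ≡⟨ cong (λ v → f r ℤ.+ + v) (closed q r H h) ⟩
      f r ℤ.+ + (suc q * (r + H * suc q + h))            ∎
      where open ≡-Reasoning

  R-mid-∸ : ∀ k x → suc (k + k) ≤ x → x < k + k + k + 2 → R k x ≡ f x ℤ.- f (x ∸ suc (k + k))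
  R-mid-∸ k x l u = subst (λ z → R k z ≡ f z ℤ.- f (x ∸ suc (k + k))) (ℕ.m+[n∸m]≡n l)
    (R-mid k (x ∸ suc (k + k)) (ℕ.+-cancelˡ-≤ (suc (k + k)) _ _
      (subst (_≤ suc (k + k) + k) (sym (ℕ.m+[n∸m]≡n l)) (ℕ.≤-pred (subst (suc x ≤_) (regroup k) u)))))
    where
    regroup : ∀ k → k + k + k + 2 ≡ suc (suc (k + k) + k)
    regroup = ℕSolver.solve-∀

  R-high-∸ : ∀ k x → k + k + k + 2 ≤ x →
    R k x ≡ f x ℤ.- f (x ∸ suc (k + k)) ℤ.- R (suc k) (x ∸ (k + k + k + 2))
  R-high-∸ k x l = subst
    (λ z → R k z ≡ f z ℤ.- f (z ∸ suc (k + k)) ℤ.- R (suc k) y) (ℕ.m+[n∸m]≡n l)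
    (trans (R-high k y) (cong (λ z → f (k + k + k + 2 + y) ℤ.- f z ℤ.- R (suc k) y)
      (sym (trans (cong (_∸ suc (k + k)) (regroup k y)) (ℕ.m+n∸m≡n (suc (k + k)) (suc k + y))))))
    where
    y = x ∸ (k + k + k + 2)
    regroup : ∀ k y → k + k + k + 2 + y ≡ suc (k + k) + (suc k + y)
    regroup = ℕSolver.solve-∀

  <ᵇ-true : ∀ {m n} → (m <ᵇ n) ≡ true → m < n
  <ᵇ-true {m} {n} eq = ℕ.<ᵇ⇒< m n (subst T (sym eq) tt)

  <ᵇ-false : ∀ {m n} → (m <ᵇ n) ≡ false → n ≤ m
  <ᵇ-false eq = ℕ.≮⇒≥ λ m<n → subst T eq (ℕ.<⇒<ᵇ m<n)

  R-fast-correct : ∀ n k x → x < n → R-fast n k x ≡ R k x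
  R-fast-correct (suc n) k x (s≤s x≤n) = if-elim (x <ᵇ suc (k + k))
    (λ eq₁ → trans (sym (f-fast x)) (sym (R-low k x (<ᵇ-true eq₁))))
    λ eq₁ → if-elim (x <ᵇ k + k + k + 2)
      (λ eq₂ → trans (sym (cong₂ ℤ._-_ (f-fast x) (f-fast (x ∸ suc (k + k)))))
                     (sym (R-mid-∸ k x (<ᵇ-false eq₁) (<ᵇ-true eq₂))))
      λ eq₂ → trans
        (cong₂ ℤ._-_ (sym (cong₂ ℤ._-_ (f-fast x) (f-fast (x ∸ suc (k + k)))))
          (R-fast-correct n (suc k) (x ∸ (k + k + k + 2)) (ℕ.<-≤-trans (decrease (<ᵇ-false eq₂)) x≤n)))
        (sym (R-high-∸ k x (<ᵇ-false eq₂)))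
    where
    decrease : k + k + k + 2 ≤ x → x ∸ (k + k + k + 2) < x
    decrease = ℕ.∸-monoʳ-< {x} {k + k + k + 2} {0} (ℕ.<-≤-trans (s≤s z≤n) (ℕ.m≤n+m 2 (k + k + k)))

  lower? = ℕ.allUpTo? (λ m → 0ℤ ℤ.≤? + c ℤ.* + nth table m ℤ.- (+ m ℤ.+ + h) ℤ.* (+ m ℤ.+ + h) ℤ.+ + a) D
  upper? = ℕ.allUpTo? (λ m → 0ℤ ℤ.≤? (+ m ℤ.+ + h) ℤ.* (+ m ℤ.+ + h) ℤ.+ + b ℤ.- + c ℤ.* + nth table m) D
  small₁? = 0ℤ ℤ.≤? + 109 ℤ.- (+ a ℤ.+ + b ℤ.+ (+ h ℤ.+ + h))
  small₂? = 0ℤ ℤ.≤? + 200 ℤ.- (+ h ℤ.* + h ℤ.+ (+ h ℤ.+ + h) ℤ.+ + a ℤ.+ (+ b ℤ.+ + b))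
  beyond? = ℕ.allUpTo? (λ i → 0ℤ ℤ.<? L (+ a) (+ (2 + i)) (+ limit i)) 12
  finite? = ℕ.allUpTo? (λ i → ℕ.allUpTo? (λ x →
    positive-or? (R-fast (suc x) (2 + i) x) (x ∈? zeros (2 + i))) (limit i)) 12
  initial-positive? = ℕ.allUpTo? (λ n → positive-or? (+ nth table n) (n ∈? zeros 14)) D

  -- Each finite check enters as a Boolean equation, which `refl` proves by evaluation.
  -- `zeros-const` lets one list serve all k ≥ 14.
  module Checked
    (lower : does lower? ≡ true) (upper : does upper? ≡ true)
    (small₁ : does small₁? ≡ true) (small₂ : does small₂? ≡ true)
    (beyond : does beyond? ≡ true) (finite : does finite? ≡ true)
    (initial-positive : does initial-positive? ≡ true)
    (zeros-const : ∀ i → zeros (14 + i) ≡ zeros 14)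
    where

    -- When n grows by D, both c·f n and (n + h)² grow by D(2n + 2h + D). Their difference is thus
    -- periodic, and the arguments below D suffice.
    f-lower : ∀ m → 0ℤ ℤ.≤ + c ℤ.* f m ℤ.- (+ m ℤ.+ + h) ℤ.* (+ m ℤ.+ + h) ℤ.+ + a
    f-lower = step-induction _ D
      (λ {n} n<D → subst (λ v → 0ℤ ℤ.≤ + c ℤ.* v ℤ.- (+ n ℤ.+ + h) ℤ.* (+ n ℤ.+ + h) ℤ.+ + a)
        (sym (f-initial n<D)) (does-true lower? lower n<D))
      λ n → subst (0ℤ ℤ.≤_) (sym (trans
        (cong (λ v → + c ℤ.* v ℤ.- (+ (n + D) ℤ.+ + h) ℤ.* (+ (n + D) ℤ.+ + h) ℤ.+ + a) (f-period n))
        (identity (+ n) (+ h) (+ H) (+ a) (f n))))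
      where
      identity : ∀ n h H a v → let D = H ℤ.+ H in
        (D ℤ.+ D) ℤ.* (v ℤ.+ ((H ℤ.+ h) ℤ.+ 1ℤ ℤ.* n)) ℤ.- (n ℤ.+ D ℤ.+ h) ℤ.* (n ℤ.+ D ℤ.+ h) ℤ.+ a ≡
        (D ℤ.+ D) ℤ.* v ℤ.- (n ℤ.+ h) ℤ.* (n ℤ.+ h) ℤ.+ a
      identity = solve-∀

    f-upper : ∀ m → 0ℤ ℤ.≤ (+ m ℤ.+ + h) ℤ.* (+ m ℤ.+ + h) ℤ.+ + b ℤ.- + c ℤ.* f m
    f-upper = step-induction _ D
      (λ {n} n<D → subst (λ v → 0ℤ ℤ.≤ (+ n ℤ.+ + h) ℤ.* (+ n ℤ.+ + h) ℤ.+ + b ℤ.- + c ℤ.* v)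
        (sym (f-initial n<D)) (does-true upper? upper n<D))
      λ n → subst (0ℤ ℤ.≤_) (sym (trans
        (cong (λ v → (+ (n + D) ℤ.+ + h) ℤ.* (+ (n + D) ℤ.+ + h) ℤ.+ + b ℤ.- + c ℤ.* v) (f-period n))
        (identity (+ n) (+ h) (+ H) (+ b) (f n))))
      where
      identity : ∀ n h H b v → let D = H ℤ.+ H in
        (n ℤ.+ D ℤ.+ h) ℤ.* (n ℤ.+ D ℤ.+ h) ℤ.+ b ℤ.- (D ℤ.+ D) ℤ.* (v ℤ.+ ((H ℤ.+ h) ℤ.+ 1ℤ ℤ.* n)) ≡
        (n ℤ.+ h) ℤ.* (n ℤ.+ h) ℤ.+ b ℤ.- (D ℤ.+ D) ℤ.* v
      identity = solve-∀

    open Bound f R R-low R-mid R-high c h a b f-lower f-upper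
      (does-true small₁? small₁) (does-true small₂? small₂)
      using (positive-beyond; positive-or-initial)

    Outcome : ℕ → ℕ → Set
    Outcome k x = 0ℤ ℤ.< R k x ⊎ (R k x ≡ 0ℤ × x ∈ zeros k)

    -- The increment H + h + n over a period is positive, so with nonnegativity carried through the
    -- induction f can vanish only below D.
    f-positive : ∀ x → 0ℤ ℤ.≤ f x × (0ℤ ℤ.< f x ⊎ (f x ≡ 0ℤ × x ∈ zeros 14))
    f-positive = step-induction _ D
      (λ {n} n<D → subst (λ v → 0ℤ ℤ.≤ v × (0ℤ ℤ.< v ⊎ (v ≡ 0ℤ × n ∈ zeros 14))) (sym (f-initial n<D))
        (ℤ.+≤+ z≤n , does-true initial-positive? initial-positive n<D))
      λ n (0≤fn , _) → let 0<f = subst (0ℤ ℤ.<_) (sym (f-period n)) (ℤ.+-mono-≤-< 0≤fn (0<+ n)) in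
        ℤ.<⇒≤ 0<f , inj₁ 0<f
      where
      0<+ : ∀ n → 0ℤ ℤ.< + (H + h) ℤ.+ 1ℤ ℤ.* + n
      0<+ n = subst (λ v → 0ℤ ℤ.< + (H + h) ℤ.+ v) (sym (ℤ.*-identityˡ (+ n)))
        (ℤ.+<+ (ℕ.<-≤-trans 0<H (ℕ.≤-trans (ℕ.m≤m+n H h) (ℕ.m≤m+n (H + h) n))))
        where
        0<H : 0 < H
        0<H = ℕ.n≢0⇒n>0 λ { refl → ≢-nonZero⁻¹ (H + H) refl }

    verdict-finite : ∀ i x → i < 12 → x < limit i → Outcome (2 + i) x
    verdict-finite i x i<12 x<l = subst (λ v → 0ℤ ℤ.< v ⊎ (v ≡ 0ℤ × x ∈ zeros (2 + i)))
      (R-fast-correct (suc x) (2 + i) x ℕ.≤-refl)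
      (does-true finite? finite i<12 x<l)

    verdict-beyond : ∀ i x → i < 12 → limit i ≤ x → Outcome (2 + i) x
    verdict-beyond i x i<12 l≤x = inj₁ (subst (λ z → 0ℤ ℤ.< R (2 + i) z) (ℕ.m+[n∸m]≡n l≤x)
      (positive-beyond (suc i) (limit i) (does-true beyond? beyond i<12) (x ∸ limit i)))

    verdict-large : ∀ j x → Outcome (14 + j) x
    verdict-large j x = case positive-or-initial j x of λ where
      (inj₁ 0<R) → inj₁ 0<R
      (inj₂ R≡f) → subst₂ (λ v zs → 0ℤ ℤ.< v ⊎ (v ≡ 0ℤ × x ∈ zs)) (sym R≡f) (sym (zeros-const j)) (proj₂ (f-positive x))

    verdict : ∀ i x → Outcome (2 + i) x
    verdict i x = case i <? 12 of λ where
      (yes i<12) → case x <? limit i of λ where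
        (yes x<l) → verdict-finite i x i<12 x<l
        (no x≮l)  → verdict-beyond i x i<12 (ℕ.≮⇒≥ x≮l)
      (no i≮12)  → subst (λ i → Outcome (2 + i) x) (ℕ.m+[n∸m]≡n (ℕ.≮⇒≥ i≮12)) (verdict-large (i ∸ 12) x)

-- Periodicity and conclusion for one triple

module Triple
  (α β γ : ℕ) .{{_ : NonZero α}} .{{_ : NonZero β}} .{{_ : NonZero γ}}
  -- αβγ = 2H and α + β + γ = 2h.
  (H h : ℕ) .{{_ : NonZero (H + H)}} (table : List ℕ)
  where

  D : ℕ
  D = H + H

  g f : PowerSeries
  g = 1/[1-q^ α ] ⊛ 1/[1-q^ β ]
  f = g ⊛ 1/[1-q^ γ ]

  open Truncated f

  period₁? = ℕ.allUpTo? (λ n → 1/[1-q^ α ] (n + D) ℤ.≟ 1/[1-q^ α ] n) α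
  period₂? = ℕ.allUpTo? (λ n → g (n + D) ℤ.≟ g n ℤ.+ (+ γ ℤ.+ 0ℤ ℤ.* + n)) β
  period₃? = ℕ.allUpTo? (λ n → f (n + D) ℤ.≟ f n ℤ.+ (+ (H + h) ℤ.+ 1ℤ ℤ.* + n)) γ
  initial? = ℕ.allUpTo? (λ n → f n ℤ.≟ + nth table n) D

  module Periodic
    (period₁ : does period₁? ≡ true) (period₂ : does period₂? ≡ true)
    (period₃ : does period₃? ≡ true) (initial : does initial? ≡ true)
    where

    f-initial : ∀ {n} → n < D → f n ≡ + nth table n
    f-initial = does-true initial? initial

    -- The increment is that of (n + h)²/(2D). The geometric factors are multiplied in one by one:
    -- over D the increments are 0, then γ = D/(αβ), then H + h + n.
    f-period : ∀ n → f (n + D) ≡ f n ℤ.+ (+ (H + h) ℤ.+ 1ℤ ℤ.* + n)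
    f-period = ⊛-geometric-quasiperiodic g γ D 1ℤ (+ (H + h))
      (λ n → trans (g-period n) (cong (λ z → g n ℤ.+ z) (0*n+γ (+ γ) (+ n))))
      λ n<γ → does-true period₃? period₃ n<γ
      where
      0*n+γ : ∀ γ n → γ ℤ.+ 0ℤ ℤ.* n ≡ 1ℤ ℤ.* γ
      0*n+γ = solve-∀
      swap : ∀ n a D → n + a + D ≡ n + D + a
      swap = ℕSolver.solve-∀
      periodic : ∀ n → 1/[1-q^ α ] (n + α) ≡ 1/[1-q^ α ] n
      periodic n = trans (1/[1-q^]-periodic α (n + α) (ℕ.m≤n+m α n)) (cong 1/[1-q^ α ] (ℕ.m+n∸n≡m n α))
      e-period : ∀ n → 1/[1-q^ α ] (n + D) ≡ 1/[1-q^ α ] n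
      e-period = step-induction _ α
        (λ n<α → does-true period₁? period₁ n<α)
        λ n ih → trans (trans (cong 1/[1-q^ α ] (swap n α D)) (periodic (n + D))) (trans ih (sym (periodic n)))
      g-period : ∀ n → g (n + D) ≡ g n ℤ.+ (+ γ ℤ.+ 0ℤ ℤ.* + n)
      g-period = ⊛-geometric-quasiperiodic 1/[1-q^ α ] β D 0ℤ (+ γ)
        (λ n → trans (e-period n) (sym (ℤ.+-identityʳ _)))
        λ n<β → does-true period₂? period₂ n<β

    module Positive (a b : ℕ) (zeros : ℕ → List ℕ) where
      open Verdict f R R-low R-mid R-high H h a b table zeros f-initial f-period public

    R-1 : f 1 ≡ 0ℤ → ∀ {k} → 2 ≤ k → R k 1 ≡ 0ℤ
    R-1 f1≡0 {suc k} _ = trans (R-low (suc k) 1 (s≤s (s≤s z≤n))) f1≡0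

  conclude : (zeros : ℕ → List ℕ) →
    (∀ i x → 0ℤ ℤ.< R (2 + i) x ⊎ (R (2 + i) x ≡ 0ℤ × x ∈ zeros (2 + i))) →
    (∀ i {x} → x ∈ zeros (2 + i) → Exceptional (α , β , γ) (2 + i) (pent (2 + i) + x)) →
    (∀ {k n} → Exceptional (α , β , γ) k n → TP α β γ k n ≡ 0ℤ) →
    (k n : ℕ) → 2 ≤ k → pent k ≤ n →
    (0ℤ ℤ.≤ TP α β γ k n) ×
    (¬ Exceptional (α , β , γ) k n → 0ℤ ℤ.< TP α β γ k n) ×
    (Exceptional (α , β , γ) k n → TP α β γ k n ≡ 0ℤ)
  conclude zeros verdict exceptional vanishing (suc zero) _ (s≤s ())
  conclude zeros verdict exceptional vanishing k@(suc (suc i)) n _ p≤n =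
    -- For n = pent k + x, the value `TP α β γ k n` is `R k x` by definition.
    subst Claim (ℕ.m+[n∸m]≡n p≤n) (from (verdict i (n ∸ pent k)))
    where
    Claim : ℕ → Set
    Claim n = (0ℤ ℤ.≤ TP α β γ k n) ×
              (¬ Exceptional (α , β , γ) k n → 0ℤ ℤ.< TP α β γ k n) ×
              (Exceptional (α , β , γ) k n → TP α β γ k n ≡ 0ℤ)
    from : ∀ {x} → 0ℤ ℤ.< R k x ⊎ (R k x ≡ 0ℤ × x ∈ zeros k) → Claim (pent k + x)
    from (inj₁ 0<R)        = ℤ.<⇒≤ 0<R , (λ _ → 0<R) , vanishing
    from (inj₂ (R≡0 , x∈)) =
      ℤ.≤-reflexive (sym R≡0) , (λ ¬exc → ⊥-elim (¬exc (exceptional i x∈))) , λ _ → R≡0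

-- The three triples

module Triple149 where
  table : List ℕ
  table =
    1 ∷ 1 ∷ 1 ∷ 1 ∷ 2 ∷ 2 ∷ 2 ∷ 2 ∷ 3 ∷ 4 ∷ 4 ∷ 4 ∷ 5 ∷ 6 ∷ 6 ∷ 6 ∷ 7 ∷ 8 ∷ 9 ∷ 9 ∷ 10 ∷
    11 ∷ 12 ∷ 12 ∷ 13 ∷ 14 ∷ 15 ∷ 16 ∷ 17 ∷ 18 ∷ 19 ∷ 20 ∷ 21 ∷ 22 ∷ 23 ∷ 24 ∷ []

  -- The entries are offsets n - pent k. As pent 2 = 7, those for k = 2 stand for n = 21, 24, 25.
  zeros : ℕ → List ℕ
  zeros 2 = 14 ∷ 17 ∷ 18 ∷ []
  zeros _ = []

  open Triple 1 4 9 18 7 table using (module Periodic)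
  open Periodic refl refl refl refl using (module Positive)
  -- The extreme values of 72p(m) - (m + 7)² are -52, at m = 7, and 32, at m = 9.
  open Positive 52 32 zeros using (module Checked; R-fast-correct)

  verdict = Checked.verdict refl refl refl refl refl refl refl (λ _ → refl)

  exceptional : ∀ i {x} → x ∈ zeros (2 + i) → Exceptional (1 , 4 , 9) (2 + i) (pent (2 + i) + x)
  exceptional zero (here refl)                 = exc-149 (here refl)
  exceptional zero (there (here refl))         = exc-149 (there (here refl))
  exceptional zero (there (there (here refl))) = exc-149 (there (there (here refl)))

  vanishing : ∀ {k n} → Exceptional (1 , 4 , 9) k n → TP 1 4 9 k n ≡ 0ℤ
  -- `R-fast 15 2 14` evaluates to 0, and offset 14 means n = 7 + 14 = 21.
  vanishing (exc-149 (here refl))                 = sym (R-fast-correct 15 2 14 ℕ.≤-refl)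
  vanishing (exc-149 (there (here refl)))         = sym (R-fast-correct 18 2 17 ℕ.≤-refl)
  vanishing (exc-149 (there (there (here refl)))) = sym (R-fast-correct 19 2 18 ℕ.≤-refl)

module Triple235 where
  table : List ℕ
  table =
    1 ∷ 0 ∷ 1 ∷ 1 ∷ 1 ∷ 2 ∷ 2 ∷ 2 ∷ 3 ∷ 3 ∷ 4 ∷ 4 ∷ 5 ∷ 5 ∷ 6 ∷ 7 ∷ 7 ∷ 8 ∷ 9 ∷ 9 ∷ 11 ∷
    11 ∷ 12 ∷ 13 ∷ 14 ∷ 15 ∷ 16 ∷ 17 ∷ 18 ∷ 19 ∷ []

  zeros : ℕ → List ℕ
  zeros 2 = 1 ∷ 13 ∷ 16 ∷ []
  zeros _ = 1 ∷ []

  open Triple 2 3 5 15 5 table using (module Periodic)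
  open Periodic refl refl refl refl using (module Positive; R-1)
  -- The extreme values of 60p(m) - (m + 5)² are -36, at m = 1, and 35, at m = 0.
  open Positive 36 35 zeros using (module Checked; R-fast-correct)

  verdict = Checked.verdict refl refl refl refl refl refl refl (λ _ → refl)

  exceptional : ∀ i {x} → x ∈ zeros (2 + i) → Exceptional (2 , 3 , 5) (2 + i) (pent (2 + i) + x)
  exceptional zero    (here refl)                 = suc-235 (s≤s (s≤s z≤n)) refl
  exceptional zero    (there (here refl))         = exc-235 (here refl)
  exceptional zero    (there (there (here refl))) = exc-235 (there (here refl))
  exceptional (suc i) (here refl)                 = suc-235 (s≤s (s≤s z≤n)) refl

  vanishing : ∀ {k n} → Exceptional (2 , 3 , 5) k n → TP 2 3 5 k n ≡ 0ℤ
  vanishing (exc-235 (here refl))         = sym (R-fast-correct 14 2 13 ℕ.≤-refl)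
  vanishing (exc-235 (there (here refl))) = sym (R-fast-correct 17 2 16 ℕ.≤-refl)
  vanishing (suc-235 2≤k refl)            = R-1 refl 2≤k

module Triple237 where
  table : List ℕ
  table =
    1 ∷ 0 ∷ 1 ∷ 1 ∷ 1 ∷ 1 ∷ 2 ∷ 2 ∷ 2 ∷ 3 ∷ 3 ∷ 3 ∷ 4 ∷ 4 ∷ 5 ∷ 5 ∷ 6 ∷ 6 ∷ 7 ∷ 7 ∷ 8 ∷
    9 ∷ 9 ∷ 10 ∷ 11 ∷ 11 ∷ 12 ∷ 13 ∷ 14 ∷ 14 ∷ 16 ∷ 16 ∷ 17 ∷ 18 ∷ 19 ∷ 20 ∷ 21 ∷ 22 ∷ 23 ∷ 24 ∷ 25 ∷ 26 ∷ []

  zeros : ℕ → List ℕ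
  zeros 2 = 1 ∷ 5 ∷ 8 ∷ 11 ∷ 14 ∷ 17 ∷ 20 ∷ []
  zeros _ = 1 ∷ []

  open Triple 2 3 7 21 6 table using (module Periodic)
  open Periodic refl refl refl refl using (module Positive; R-1)
  -- The extreme values of 84p(m) - (m + 6)² are -49, at m = 1, and 48, at m = 0. Here a + b + 2h =
  -- 109 exhausts the budget `small₁`.
  open Positive 49 48 zeros using (module Checked; R-fast-correct)

  verdict = Checked.verdict refl refl refl refl refl refl refl (λ _ → refl)

  exceptional : ∀ i {x} → x ∈ zeros (2 + i) → Exceptional (2 , 3 , 7) (2 + i) (pent (2 + i) + x)
  exceptional zero    (here refl) = suc-237 (s≤s (s≤s z≤n)) refl
  exceptional zero    (there (here refl)) = exc-237 {j = 4} (ℕ.m≤m+n 4 0) (ℕ.m≤m+n 4 5) refl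
  exceptional zero    (there (there (here refl))) = exc-237 {j = 5} (ℕ.m≤m+n 4 1) (ℕ.m≤m+n 5 4) refl
  exceptional zero    (there (there (there (here refl)))) = exc-237 {j = 6} (ℕ.m≤m+n 4 2) (ℕ.m≤m+n 6 3) refl
  exceptional zero    (there (there (there (there (here refl))))) = exc-237 {j = 7} (ℕ.m≤m+n 4 3) (ℕ.m≤m+n 7 2) refl
  exceptional zero    (there (there (there (there (there (here refl)))))) = exc-237 {j = 8} (ℕ.m≤m+n 4 4) (ℕ.m≤m+n 8 1) refl
  exceptional zero    (there (there (there (there (there (there (here refl))))))) = exc-237 {j = 9} (ℕ.m≤m+n 4 5) (ℕ.m≤m+n 9 0) refl
  exceptional (suc i) (here refl) = suc-237 (s≤s (s≤s z≤n)) refl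

  vanishing : ∀ {k n} → Exceptional (2 , 3 , 7) k n → TP 2 3 7 k n ≡ 0ℤ
  vanishing (exc-237 {4} _ _ refl) = sym (R-fast-correct 6 2 5 ℕ.≤-refl)
  vanishing (exc-237 {5} _ _ refl) = sym (R-fast-correct 9 2 8 ℕ.≤-refl)
  vanishing (exc-237 {6} _ _ refl) = sym (R-fast-correct 12 2 11 ℕ.≤-refl)
  vanishing (exc-237 {7} _ _ refl) = sym (R-fast-correct 15 2 14 ℕ.≤-refl)
  vanishing (exc-237 {8} _ _ refl) = sym (R-fast-correct 18 2 17 ℕ.≤-refl)
  vanishing (exc-237 {9} _ _ refl) = sym (R-fast-correct 21 2 20 ℕ.≤-refl)
  vanishing (exc-237 {0} () _ _)
  vanishing (exc-237 {1} (s≤s ()) _ _)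
  vanishing (exc-237 {2} (s≤s (s≤s ())) _ _)
  vanishing (exc-237 {3} (s≤s (s≤s (s≤s ()))) _ _)
  vanishing (exc-237 {suc (suc (suc (suc (suc (suc (suc (suc (suc (suc _)))))))))} _ j≤9 _) =
    ⊥-elim (ℕ.<⇒≱ (ℕ.m≤m+n 10 _) j≤9)
  vanishing (suc-237 2≤k refl) = R-1 refl 2≤k

theorem1p2 : (α β γ : ℕ) .{{_ : NonZero α}} .{{_ : NonZero β}} .{{_ : NonZero γ}} →
    (α , β , γ) ∈ (1 , 4 , 9) ∷ (2 , 3 , 5) ∷ (2 , 3 , 7) ∷ [] →
    (k n : ℕ) → 2 ≤ k → pent k ≤ n →
    (0ℤ ℤ.≤ TP α β γ k n) ×
    (¬ Exceptional (α , β , γ) k n → 0ℤ ℤ.< TP α β γ k n) ×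
    (Exceptional (α , β , γ) k n → TP α β γ k n ≡ 0ℤ)
theorem1p2 _ _ _ (here refl) = Triple.conclude 1 4 9 18 7 table zeros verdict exceptional vanishing
  where open Triple149
theorem1p2 _ _ _ (there (here refl)) = Triple.conclude 2 3 5 15 5 table zeros verdict exceptional vanishing
  where open Triple235
theorem1p2 _ _ _ (there (there (here refl))) = Triple.conclude 2 3 7 21 6 table zeros verdict exceptional vanishing
  where open Triple237
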